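{- For an integer $m\ge0$ let $\mathbf{S}_m=\{1,\dots,m\}^2$, and let $A_{\mathbf{S}}(m,k)$ be the number of $k$-element subsets of $\mathbf{S}_m$ such that no two distinct elements $(i,j),(i',j')$ satisfy $i=i'$ or $i-j=i'-j'$ (nonattacking placements of $k$ anassas with moves $(0,1),(1,1)$). Then for all integers $m,k\ge0$, $$A_{\mathbf{S}}(m,k)=\sum_{j=0}^{\lceil k/2\rceil}(m-k+j)_j\left\{ {m \atop m-k+j}\right\}2^{k-2j}\left[\binom{k-j}{j-1}+\binom{k-j+1}{j}\right].$$
   Context: $(x)_j=x(x-1)\cdots(x-j+1)$, $(x)_0=1$. Stirling numbers of the second kind $\left\{ {n \atop r}\right\}$ are used in the extended sense for all integers: usual values for $n,r\ge0$; $\left\{ {n \atop r}\right\}=\left[{ -r\atop -n}\right]$ (unsigned Stirling number of the first kind) for $n,r\le0$; and $0$ when one of $n,r$ is positive and the other negative. Binomial coefficients are extended to all integers (Kronenburg's convention): $\binom{n}{r}=n(n-1)\cdots(n-r+1)/r!$ if $r\ge0$; $\binom{n}{r}=(-1)^{n-r}\binom{ -r-1}{n-r}$ if $r\le n<0$; $0$ otherwise. -}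

module Defs where

open import Data.Fin using (Fin; toℕ; combine)
import Data.Fin.Properties as Fin
open import Data.Fin.Subset using (Subset; inside; outside; ∣_∣; _∈_)
open import Data.Fin.Subset.Properties using (_∈?_)
open import Data.Integer as ℤ using (ℤ; +_; -[1+_]; 0ℤ; 1ℤ; -1ℤ)
import Data.Integer.Properties as ℤ
open import Data.List using (List; []; _∷_; _++_; map; filter; foldr; length; upTo)
import Data.List.Membership.Propositional as List
open import Data.List.Membership.Propositional.Properties using (∈-map⁺; ∈-map⁻; ∈-++⁺ˡ; ∈-++⁺ʳ)
open import Data.List.Relation.Unary.All using ([])
open import Data.List.Relation.Unary.AllPairs using ([]; _∷_)
open import Data.List.Relation.Unary.Any using (here)
open import Data.List.Relation.Unary.Unique.Propositional using (Unique)
import Data.List.Relation.Unary.Unique.Propositional.Properties as Unique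
open import Data.Nat as ℕ using (ℕ; zero; suc; _!)
open import Data.Nat.Combinatorics using (_C_)
import Data.Nat.Properties as ℕ
open import Data.Product using (_×_; _,_)
open import Data.Product.Properties using (≡-dec)
open import Data.Rational as ℚ using (ℚ; 0ℚ; _/_)
open import Data.Sum using (_⊎_)
open import Data.Vec using ([]; _∷_)
open import Data.Vec.Properties using (∷-injectiveʳ)
open import Relation.Binary.PropositionalEquality using (_≡_; _≢_; refl; trans; sym)
open import Relation.Nullary using (¬_; Dec; yes; no; ¬?; _×-dec_; _⊎-dec_; _→-dec_)

subsets : (n : ℕ) → List (Subset n)
subsets zero    = [] ∷ []
subsets (suc n) = map (outside ∷_) (subsets n) ++ map (inside ∷_) (subsets n)

∈-subsets : ∀ {n} (s : Subset n) → s List.∈ subsets n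
∈-subsets []            = here refl
∈-subsets (outside ∷ s) = ∈-++⁺ˡ (∈-map⁺ (outside ∷_) (∈-subsets s))
∈-subsets (inside ∷ s)  = ∈-++⁺ʳ (map (outside ∷_) (subsets _)) (∈-map⁺ (inside ∷_) (∈-subsets s))

subsets-unique : ∀ n → Unique (subsets n)
subsets-unique zero    = [] ∷ []
subsets-unique (suc n) =
  Unique.++⁺ (Unique.map⁺ ∷-injectiveʳ (subsets-unique n))
             (Unique.map⁺ ∷-injectiveʳ (subsets-unique n))
             λ (p , q) → clash (∈-map⁻ (outside ∷_) p) (∈-map⁻ (inside ∷_) q)
  where
  open import Data.Empty using (⊥)
  open import Data.Product using (∃)
  clash : ∀ {s} → ∃ (λ t → t List.∈ subsets n × s ≡ outside ∷ t) →
          ∃ (λ t → t List.∈ subsets n × s ≡ inside ∷ t) → ⊥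
  clash (_ , _ , p) (_ , _ , q) with trans (sym p) q
  ... | ()

-- The index i : Fin m stands for the element i + 1 of {1,…,m}.
coord : ∀ {m} → Fin m → ℤ
coord i = + suc (toℕ i)

-- A subset of {1,…,m}² is a Subset (m * m), through the bijection
-- combine : Fin m → Fin m → Fin (m * m).
NonAttacking : ∀ m → Subset (m ℕ.* m) → Set
NonAttacking m s = ∀ (i j i′ j′ : Fin m) →
  combine i j ∈ s → combine i′ j′ ∈ s → (i , j) ≢ (i′ , j′) →
  ¬ (coord i ≡ coord i′ ⊎ coord i ℤ.- coord j ≡ coord i′ ℤ.- coord j′)

nonAttacking? : ∀ m s → Dec (NonAttacking m s)
nonAttacking? m s =
  Fin.all? λ i → Fin.all? λ j → Fin.all? λ i′ → Fin.all? λ j′ →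
  (combine i j ∈? s) →-dec (combine i′ j′ ∈? s) →-dec
  ¬? (≡-dec Fin._≟_ Fin._≟_ (i , j) (i′ , j′)) →-dec
  ¬? ((coord i ℤ.≟ coord i′) ⊎-dec (coord i ℤ.- coord j ℤ.≟ coord i′ ℤ.- coord j′))

A-S : ℕ → ℕ → ℕ
A-S m k = length (filter (λ s → (∣ s ∣ ℕ.≟ k) ×-dec nonAttacking? m s) (subsets (m ℕ.* m)))

fallingFactorial : ℤ → ℕ → ℤ
fallingFactorial x zero    = 1ℤ
fallingFactorial x (suc j) = fallingFactorial x j ℤ.* (x ℤ.- + j)

stirling₂ : ℕ → ℕ → ℕ
stirling₂ zero    zero    = 1
stirling₂ zero    (suc r) = 0
stirling₂ (suc n) zero    = 0
stirling₂ (suc n) (suc r) = suc r ℕ.* stirling₂ n (suc r) ℕ.+ stirling₂ n r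

-- unsigned
stirling₁ : ℕ → ℕ → ℕ
stirling₁ zero    zero    = 1
stirling₁ zero    (suc r) = 0
stirling₁ (suc n) zero    = 0
stirling₁ (suc n) (suc r) = n ℕ.* stirling₁ n (suc r) ℕ.+ stirling₁ n r

-- { n over r } = [ -r over -n ] for n, r ≤ 0; where n = r = 0 this agrees with
-- the first clause.
extStirling₂ : ℤ → ℤ → ℕ
extStirling₂ (+ n)     (+ r)     = stirling₂ n r
extStirling₂ (+ 0)     -[1+ r ]  = stirling₁ (suc r) 0
extStirling₂ (+ suc n) -[1+ r ]  = 0
extStirling₂ -[1+ n ]  (+ 0)     = stirling₁ 0 (suc n)
extStirling₂ -[1+ n ]  (+ suc r) = 0
extStirling₂ -[1+ n ]  -[1+ r ]  = stirling₁ (suc r) (suc n)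

-- Kronenburg's convention. For N = -[1+ n ] and R = -[1+ r ]: R ≤ N iff n ≤ r,
-- N - R = r - n, and -R - 1 = r.
extBinomial : ℤ → ℤ → ℚ
extBinomial n        (+ r)    = (fallingFactorial n r / r !) {{r ℕ.!≢0}}
extBinomial (+ n)    -[1+ r ] = 0ℚ
extBinomial -[1+ n ] -[1+ r ] with n ℕ.≤? r
... | yes _ = ((-1ℤ ℤ.^ (r ℕ.∸ n)) ℤ.* + (r C (r ℕ.∸ n))) / 1
... | no  _ = 0ℚ

2^_ : ℤ → ℚ
2^ (+ n)    = + (2 ℕ.^ n) / 1
2^ -[1+ n ] = (1ℤ / (2 ℕ.^ suc n)) {{ℕ.m^n≢0 2 (suc n)}}

∑[0⋯_] : ℕ → (ℕ → ℚ) → ℚ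
∑[0⋯ n ] f = foldr ℚ._+_ 0ℚ (map f (upTo (suc n)))

{-# OPTIONS --safe #-}

-- Send the square (i, j) to the row i and the column i + (m - 1 - j) of a
-- parallelogram board; a nonattacking placement is then a rook placement. Columns
-- c < m meet the rows 0, …, c, and columns m + c meet the rows c + 1, …, m - 1.
-- Run through t = 0, …, m - 1: row t chooses one of the b free columns m + c with
-- c < t, and then column t chooses one of the r free rows i ≤ t. So the placements
-- are counted by iterating an operator on functions of (r, b). Up to moving the
-- choice of column t to the start of the next step, a step is the insertion of a
-- new largest index; it commutes with the insertion of a new smallest one, hence
-- both give the same totals. In their average the weights b and z = t + r - b add
-- up to t + r, so it acts on functions of r alone. With (D ψ)(r) = r ψ(r - 1) this
-- averaged step yields the total ∑ₗ { t over t - l } ((2 + D)ˡ ψ)(t - l). The last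
-- column contributes a factor 1 + D, and
-- [xʲ] (1 + x)(2 + x)ˡ = 2^(l - j) (C(l, j - 1) + C(l + 1, j)).
module Submission where

open import Defs

module Placements where
  open import Data.Bool using (true; false)
  open import Data.Fin using (Fin; zero; suc; toℕ; combine; remQuot; opposite; fromℕ<)
  import Data.Fin.Properties as Fin
  open import Data.Fin.Subset using (Subset; inside; outside; ∣_∣; _∈_)
  import Data.Integer as ℤ
  import Data.Integer.Properties as ℤ
  open import Algebra.Properties.AbelianGroup ℤ.+-0-abelianGroup using (∙-cancelʳ)
  import Data.Integer.Tactic.RingSolver as ℤ-Solver
  open import Data.List using (List; []; _∷_; _++_; map; filter; length; downFrom; tabulate)
  open import Data.List.Membership.Propositional using () renaming (_∈_ to _∈ˡ_)
  open import Data.List.Membership.Propositional.Properties using (∈-map⁺; ∈-map⁻; ∈-++⁺ˡ; ∈-++⁺ʳ; ∈-++⁻; ∈-downFrom⁺; ∈-downFrom⁻; ∈-tabulate⁺; ∈-tabulate⁻)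
  open import Data.List.Membership.Propositional.Properties.WithK using (unique∧set⇒bag)
  open import Data.List.Properties using (filter-++; length-++; filter-none; filter-accept; filter-reject)
  open import Data.List.Relation.Binary.BagAndSetEquality using (∼bag⇒↭)
  open import Data.List.Relation.Binary.Permutation.Propositional as ↭ using (_↭_)
  open import Data.List.Relation.Binary.Permutation.Propositional.Properties using (All-resp-↭)
  open import Data.List.Relation.Unary.All as All using (All; []; _∷_; all?)
  open import Data.List.Relation.Unary.AllPairs using ([])
  open import Data.List.Relation.Unary.Any using (here; there)
  open import Data.List.Relation.Unary.Unique.Propositional using (Unique)
  import Data.List.Relation.Unary.Unique.Propositional.Properties as Unique
  open import Data.Nat as ℕ using (ℕ; zero; suc; pred; _+_; _*_; _<_; _≤_; s≤s; z≤n)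
  import Data.Nat.Properties as ℕ
  open import Data.Nat.Tactic.RingSolver using (solve-∀)
  open import Data.Product using (_×_; _,_; proj₁; proj₂)
  open import Data.Product.Properties using (,-injectiveˡ; ,-injectiveʳ)
  open import Data.Sum using (_⊎_; inj₁; inj₂; [_,_]′)
  open import Data.Vec using ([]; _∷_; here; there)
  open import Function using (_∘_; mk⇔)
  open import Level using (Level)
  open import Relation.Binary.PropositionalEquality
  open import Relation.Nullary using (¬_; Dec; yes; no; does; contradiction; ¬?; _×-dec_)
  open import Relation.Unary using (Pred; Decidable; _≐_)

  private variable
    p q ℓ : Level
    A B : Set

  -- Nonattacking placements as sublists of a list of cells

  Cell : Set
  Cell = ℕ × ℕ

  Compatible : Cell → Cell → Set
  Compatible (i , c) (i′ , c′) = i ≢ i′ × c ≢ c′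

  compatible? : ∀ x y → Dec (Compatible x y)
  compatible? (i , c) (i′ , c′) = ¬? (i ℕ.≟ i′) ×-dec ¬? (c ℕ.≟ c′)

  Compatible-sym : ∀ {x y} → Compatible x y → Compatible y x
  Compatible-sym (p , q) = p ∘ sym , q ∘ sym

  Free : List Cell → Cell → Set
  Free U x = All (Compatible x) U

  free? : ∀ U x → Dec (Free U x)
  free? U x = all? (compatible? x) U

  when : ∀ {P : Set p} → Dec P → ℕ → ℕ
  when (yes _) n = n
  when (no  _) n = 0

  when-cong : ∀ {P : Set p} {Q : Set q} (P? : Dec P) (Q? : Dec Q) {m n} →
    (P → Q) → (Q → P) → (P → Q → m ≡ n) → when P? m ≡ when Q? n
  when-cong (yes p) (yes q) _ _ eq = eq p q
  when-cong (yes p) (no ¬q) f _ _  = contradiction (f p) ¬q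
  when-cong (no ¬p) (yes q) _ g _  = contradiction (g q) ¬p
  when-cong (no _)  (no _)  _ _ _  = refl

  -- The number of k-element sublists of L extending the placement U.
  count : List Cell → List Cell → ℕ → ℕ
  count U L       zero    = 1
  count U []      (suc k) = 0
  count U (x ∷ L) (suc k) = count U L (suc k) + when (free? U x) (count (x ∷ U) L k)

  count-↭ˡ : ∀ {U U′} L k → U ↭ U′ → count U L k ≡ count U′ L k
  count-↭ˡ L       zero    p = refl
  count-↭ˡ []      (suc k) p = refl
  count-↭ˡ (x ∷ L) (suc k) p = cong₂ _+_ (count-↭ˡ L (suc k) p)
    (when-cong (free? _ x) (free? _ x) (All-resp-↭ p) (All-resp-↭ (↭.↭-sym p)) λ _ _ → count-↭ˡ L k (↭.prep x p))

  when-+ : ∀ {P : Set p} (P? : Dec P) m n → when P? (m + n) ≡ when P? m + when P? n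
  when-+ (yes _) m n = refl
  when-+ (no  _) m n = refl

  when-when : ∀ {P : Set p} {Q : Set q} (P? : Dec P) (Q? : Dec Q) n →
    when P? (when Q? n) ≡ when (P? ×-dec Q?) n
  when-when (yes _) (yes _) n = refl
  when-when (yes _) (no  _) n = refl
  when-when (no  _) _       n = refl

  -- Only the sublists that contain both x and y are built differently on the two sides.
  -- `Compatible` is symmetric, so both orders admit the same ones, and afterwards U is extended by
  -- the same two cells.
  count-swap : ∀ U x y L k → count U (x ∷ y ∷ L) k ≡ count U (y ∷ x ∷ L) k
  count-swap U x y L zero          = refl
  count-swap U x y L (suc zero)    = identity (count U L 1) (when (free? U y) 1) (when (free? U x) 1)
    where
    identity : ∀ a b c → a + b + c ≡ a + c + b
    identity = solve-∀
  count-swap U x y L (suc (suc k)) = begin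
    a + when y? b + when x? (c + when yx? d)             ≡⟨ cong (a + when y? b +_) (when-+ x? c _) ⟩
    a + when y? b + (when x? c + when x? (when yx? d))   ≡⟨ cong (λ n → a + when y? b + (when x? c + n)) both ⟩
    a + when y? b + (when x? c + when y? (when xy? d′))  ≡⟨ identity a (when y? b) (when x? c) _ ⟩
    a + when x? c + (when y? b + when y? (when xy? d′))  ≡⟨ cong (a + when x? c +_) (when-+ y? b _) ⟨
    a + when x? c + when y? (b + when xy? d′)            ∎
    where
    open ≡-Reasoning
    x?  = free? U x
    y?  = free? U y
    yx? = free? (x ∷ U) y
    xy? = free? (y ∷ U) x
    a  = count U L (suc (suc k))
    b  = count (y ∷ U) L (suc k)
    c  = count (x ∷ U) L (suc k)
    d  = count (y ∷ x ∷ U) L k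
    d′ = count (x ∷ y ∷ U) L k
    identity : ∀ a b c d → a + b + (c + d) ≡ a + c + (b + d)
    identity = solve-∀
    both : when x? (when yx? d) ≡ when y? (when xy? d′)
    both = begin
      when x? (when yx? d)     ≡⟨ when-when x? yx? d ⟩
      when (x? ×-dec yx?) d    ≡⟨ when-cong (x? ×-dec yx?) (y? ×-dec xy?)
                                    (λ { (fx , yx ∷ fy) → fy , Compatible-sym yx ∷ fx })
                                    (λ { (fy , xy ∷ fx) → fx , Compatible-sym xy ∷ fy })
                                    (λ _ _ → count-↭ˡ L k (↭.swap y x ↭.refl)) ⟩
      when (y? ×-dec xy?) d′   ≡⟨ when-when y? xy? d′ ⟨
      when y? (when xy? d′)    ∎

  -- Frees the count from the order of the cells: the squares come in the order of `combine`, while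
  -- the recursion needs the order of `board`.
  count-↭ʳ : ∀ {L L′} → L ↭ L′ → ∀ U k → count U L k ≡ count U L′ k
  count-↭ʳ p            U zero    = refl
  count-↭ʳ ↭.refl         U (suc k) = refl
  count-↭ʳ (↭.prep x p)   U (suc k) =
    cong₂ _+_ (count-↭ʳ p U (suc k)) (cong (when (free? U x)) (count-↭ʳ p (x ∷ U) k))
  count-↭ʳ (↭.trans p q)  U (suc k) = trans (count-↭ʳ p U (suc k)) (count-↭ʳ q U (suc k))
  count-↭ʳ {x ∷ y ∷ L} {y ∷ x ∷ L′} (↭.swap x y p) U (suc k) =
    trans (tails (suc k)) (count-swap U x y L′ (suc k))
    where
    -- The two levels above `p` are unfolded by hand, so that the recursion stays on the subterm
    -- `p`.
    one : ∀ U k → count U (y ∷ L) k ≡ count U (y ∷ L′) k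
    one U zero    = refl
    one U (suc k) = cong₂ _+_ (count-↭ʳ p U (suc k)) (cong (when (free? U y)) (count-↭ʳ p (y ∷ U) k))
    tails : ∀ k → count U (x ∷ y ∷ L) k ≡ count U (x ∷ y ∷ L′) k
    tails zero    = refl
    tails (suc k) = cong₂ _+_ (one U (suc k)) (cong (when (free? U x)) (one (x ∷ U) k))

  -- From subsets to sublists

  length-filter-map : ∀ {P : Pred B ℓ} (P? : Decidable P) (f : A → B) xs →
    length (filter P? (map f xs)) ≡ length (filter (P? ∘ f) xs)
  length-filter-map P? f []       = refl
  length-filter-map P? f (x ∷ xs) with does (P? (f x))
  ... | true  = cong suc (length-filter-map P? f xs)
  ... | false = length-filter-map P? f xs

  Extends : ∀ {n} → List Cell → (Fin n → Cell) → Subset n → Set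
  Extends U f s = (∀ {x} → x ∈ s → Free U (f x)) × (∀ {x y} → x ∈ s → y ∈ s → x ≢ y → Compatible (f x) (f y))

  -- `P` is given only up to equivalence, so that the induction can pass to the subsets with a fixed
  -- first entry, and so that the decision procedure in `A-S` fits as it stands.
  count-subsets : ∀ n U (f : Fin n → Cell) k {P : Pred (Subset n) ℓ} (P? : Decidable P) →
    P ≐ (λ s → ∣ s ∣ ≡ k × Extends U f s) → length (filter P? (subsets n)) ≡ count U (tabulate f) k
  count-subsets zero U f zero P? (_ , to) =
    cong length (filter-accept P? {[]} {[]} (to (refl , (λ ()) , λ ())))
  count-subsets zero U f (suc k) P? (from , _) =
    cong length (filter-reject P? {[]} {[]} λ p → contradiction (proj₁ (from p)) λ ())
  count-subsets (suc n) U f k {P} P? (from , to) = begin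
    length (filter P? (map (outside ∷_) (subsets n) ++ map (inside ∷_) (subsets n)))
      ≡⟨ cong length (filter-++ P? (map (outside ∷_) (subsets n)) _) ⟩
    length (filter P? (map (outside ∷_) (subsets n)) ++ filter P? (map (inside ∷_) (subsets n)))
      ≡⟨ length-++ (filter P? (map (outside ∷_) (subsets n))) ⟩
    length (filter P? (map (outside ∷_) (subsets n))) + length (filter P? (map (inside ∷_) (subsets n)))
      ≡⟨ cong₂ _+_ (length-filter-map P? (outside ∷_) (subsets n)) (length-filter-map P? (inside ∷_) (subsets n)) ⟩
    length (filter (P? ∘ (outside ∷_)) (subsets n)) + length (filter (P? ∘ (inside ∷_)) (subsets n))
      ≡⟨ cong (_+ length (filter (P? ∘ (inside ∷_)) (subsets n)))
           (count-subsets n U (f ∘ suc) k (P? ∘ (outside ∷_)) (drop ∘ from , to ∘ skip)) ⟩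
    count U (tabulate (f ∘ suc)) k + length (filter (P? ∘ (inside ∷_)) (subsets n))
      ≡⟨ insideCount k from to ⟩
    count U (tabulate f) k ∎
    where
    open ≡-Reasoning
    drop : ∀ {s} → ∣ s ∣ ≡ k × Extends U f (outside ∷ s) → ∣ s ∣ ≡ k × Extends U (f ∘ suc) s
    drop (size , free , compat) = size , free ∘ there ,
      λ x∈ y∈ x≢y → compat (there x∈) (there y∈) (x≢y ∘ Fin.suc-injective)
    skip : ∀ {s} → ∣ s ∣ ≡ k × Extends U (f ∘ suc) s → ∣ s ∣ ≡ k × Extends U f (outside ∷ s)
    skip (size , free , compat) = size , (λ { (there x∈) → free x∈ }) ,
      λ { (there x∈) (there y∈) x≢y → compat x∈ y∈ (x≢y ∘ cong suc) }
    insideCount : ∀ k → (∀ {s} → P s → ∣ s ∣ ≡ k × Extends U f s) → (∀ {s} → ∣ s ∣ ≡ k × Extends U f s → P s) →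
      count U (tabulate (f ∘ suc)) k + length (filter (P? ∘ (inside ∷_)) (subsets n)) ≡ count U (tabulate f) k
    insideCount zero from to = cong (suc ∘ length)
      (filter-none (P? ∘ (inside ∷_)) (All.universal (λ s p → contradiction (proj₁ (from p)) λ ()) (subsets n)))
    insideCount (suc k) from to with free? U (f zero)
    ... | no ¬free = cong (λ xs → count U (tabulate (f ∘ suc)) (suc k) + length xs)
      (filter-none (P? ∘ (inside ∷_)) (All.universal (λ s p → ¬free (proj₁ (proj₂ (from p)) here)) (subsets n)))
    ... | yes free₀ = cong (count U (tabulate (f ∘ suc)) (suc k) +_)
      (count-subsets n (f zero ∷ U) (f ∘ suc) k (P? ∘ (inside ∷_)) (place ∘ from , to ∘ unplace))
      where
      place : ∀ {s} → ∣ inside ∷ s ∣ ≡ suc k × Extends U f (inside ∷ s) →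
        ∣ s ∣ ≡ k × Extends (f zero ∷ U) (f ∘ suc) s
      place (size , free , compat) = ℕ.suc-injective size ,
        (λ x∈ → compat (there x∈) here (λ ()) ∷ free (there x∈)) ,
        λ x∈ y∈ x≢y → compat (there x∈) (there y∈) (x≢y ∘ Fin.suc-injective)
      unplace : ∀ {s} → ∣ s ∣ ≡ k × Extends (f zero ∷ U) (f ∘ suc) s →
        ∣ inside ∷ s ∣ ≡ suc k × Extends U f (inside ∷ s)
      unplace (size , free , compat) = cong suc size ,
        (λ { here → free₀ ; (there x∈) → All.tail (free x∈) }) ,
        λ { here       here       x≢y → contradiction refl x≢y
          ; here       (there y∈) _   → Compatible-sym (All.head (free y∈))
          ; (there x∈) here       _   → All.head (free x∈)
          ; (there x∈) (there y∈) x≢y → compat x∈ y∈ (x≢y ∘ cong suc) }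

  -- Groups of mutually attacking cells, and tallies

  count-blocked : ∀ U xs L k → All (λ x → ¬ Free U x) xs → count U (xs ++ L) k ≡ count U L k
  count-blocked U xs       L zero    _ = refl
  count-blocked U []       L (suc k) _ = refl
  count-blocked U (x ∷ xs) L (suc k) (¬fx ∷ ¬fxs) with free? U x
  ... | yes fx = contradiction fx ¬fx
  ... | no  _  = trans (ℕ.+-identityʳ _) (count-blocked U xs L (suc k) ¬fxs)

  -- A placement uses at most one cell of such a group. As every free cell of it leaves the same
  -- number v of continuations, only the number of free cells matters.
  count-group : ∀ (g : ℕ → Cell) → (∀ i j → ¬ Compatible (g i) (g j)) → ∀ U L k v is →
    (∀ i → i ∈ˡ is → Free U (g i) → count (g i ∷ U) L k ≡ v) →
    count U (map g is ++ L) (suc k) ≡ count U L (suc k) + length (filter (free? U ∘ g) is) * v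
  count-group g attack U L k v []       _     = sym (ℕ.+-identityʳ _)
  count-group g attack U L k v (i ∷ is) value with free? U (g i)
  ... | no _ = trans (ℕ.+-identityʳ _) (count-group g attack U L k v is (λ j → value j ∘ there))
  ... | yes fi = begin
    count U (map g is ++ L) (suc k) + count (g i ∷ U) (map g is ++ L) k
      ≡⟨ cong₂ _+_ (count-group g attack U L k v is (λ j → value j ∘ there))
                   (trans (count-blocked (g i ∷ U) (map g is) L k blocked) (value i (here refl) fi)) ⟩
    count U L (suc k) + n * v + v   ≡⟨ identity (count U L (suc k)) n v ⟩
    count U L (suc k) + (v + n * v) ∎
    where
    open ≡-Reasoning
    n = length (filter (free? U ∘ g) is)
    identity : ∀ a n v → a + n * v + v ≡ a + (v + n * v)
    identity = solve-∀
    blocked : All (λ x → ¬ Free (g i ∷ U) x) (map g is)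
    blocked = All.tabulate λ x∈ → λ { (xi ∷ _) → let (j , _ , eq) = ∈-map⁻ g x∈ in
      attack j i (subst (λ x → Compatible x (g i)) eq xi) }

  -- The enumeration by `downFrom` is that of `rowGroup` and `colGroup`, so the length in
  -- `count-group` is a tally by definition.
  tally : {P : Pred ℕ p} → Decidable P → ℕ → ℕ
  tally P? n = length (filter P? (downFrom n))

  tally-cong : {P : Pred ℕ p} {Q : Pred ℕ q} (P? : Decidable P) (Q? : Decidable Q) → ∀ n →
    (∀ {j} → j < n → P j → Q j) → (∀ {j} → j < n → Q j → P j) → tally P? n ≡ tally Q? n
  tally-cong P? Q? zero    to from = refl
  tally-cong P? Q? (suc n) to from
    with P? n | Q? n | tally-cong P? Q? n (to ∘ ℕ.m<n⇒m<1+n) (from ∘ ℕ.m<n⇒m<1+n)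
  ... | yes _  | yes _  | ih = cong suc ih
  ... | no  _  | no  _  | ih = ih
  ... | yes pn | no ¬qn | _  = contradiction (to ℕ.≤-refl pn) ¬qn
  ... | no ¬pn | yes qn | _  = contradiction (from ℕ.≤-refl qn) ¬pn

  tally-accept : {P : Pred ℕ p} (P? : Decidable P) → ∀ {n} → P n → tally P? (suc n) ≡ suc (tally P? n)
  tally-accept P? {n} pn with P? n
  ... | yes _  = refl
  ... | no ¬pn = contradiction pn ¬pn

  tally-reject : {P : Pred ℕ p} (P? : Decidable P) → ∀ {n} → ¬ P n → tally P? (suc n) ≡ tally P? n
  tally-reject P? {n} ¬pn with P? n
  ... | yes pn = contradiction pn ¬pn
  ... | no _   = refl

  tally-remove : {P : Pred ℕ p} {Q : Pred ℕ q} (P? : Decidable P) (Q? : Decidable Q) → ∀ n {i} → i < n → P i → ¬ Q i →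
    (∀ {j} → P j → j ≢ i → Q j) → (∀ {j} → Q j → P j) → tally P? n ≡ suc (tally Q? n)
  tally-remove P? Q? (suc n) {i} i<1+n pi ¬qi to from with i ℕ.≟ n
  ... | yes refl = begin
    tally P? (suc n)         ≡⟨ tally-accept P? pi ⟩
    suc (tally P? n)         ≡⟨ cong suc (tally-cong P? Q? n (λ j<n pj → to pj (ℕ.<⇒≢ j<n)) (λ _ → from)) ⟩
    suc (tally Q? n)         ≡⟨ cong suc (tally-reject Q? ¬qi) ⟨
    suc (tally Q? (suc n))   ∎
    where open ≡-Reasoning
  ... | no i≢n with P? n | Q? n | tally-remove P? Q? n (ℕ.≤∧≢⇒< (ℕ.s≤s⁻¹ i<1+n) i≢n) pi ¬qi to from
  ... | yes _  | yes _  | ih = cong suc ih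
  ... | no  _  | no  _  | ih = ih
  ... | yes pn | no ¬qn | _  = contradiction (to pn (i≢n ∘ sym)) ¬qn
  ... | no ¬pn | yes qn | _  = contradiction (from qn) ¬pn

  -- The ways to place k more rooks in n further steps, with r free rows and b free
  -- columns m + c so far; completionsFromCol starts at a column choice, before those n steps.
  completions completionsFromCol : (n r b k : ℕ) → ℕ
  completions n       r b zero    = 1
  completions zero    r b (suc k) = 0
  completions (suc n) r b (suc k) =
    completionsFromCol n (suc r) (suc b) (suc k) ℕ.+ b ℕ.* completionsFromCol n r b k
  completionsFromCol n r b zero    = 1
  completionsFromCol n r b (suc k) = completions n r b (suc k) ℕ.+ r ℕ.* completions n (pred r) b k

  -- The board in the order of the steps

  rowGroup : ℕ → ℕ → List Cell
  rowGroup m t = map (λ c → t , m + c) (downFrom t)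

  colGroup : ℕ → List Cell
  colGroup t = map (_, t) (downFrom (suc t))

  -- The cells of the steps t, ..., t + n - 1; `board m m 0` is the whole parallelogram.
  board : ℕ → ℕ → ℕ → List Cell
  board m zero    t = []
  board m (suc n) t = rowGroup m t ++ colGroup t ++ board m n (suc t)

  RowFree ColFree : List Cell → ℕ → Set
  RowFree U i = All (λ y → i ≢ proj₁ y) U
  ColFree U c = All (λ y → c ≢ proj₂ y) U

  rowFree? : ∀ U i → Dec (RowFree U i)
  rowFree? U i = all? (λ y → ¬? (i ℕ.≟ proj₁ y)) U

  colFree? : ∀ U c → Dec (ColFree U c)
  colFree? U c = all? (λ y → ¬? (c ℕ.≟ proj₂ y)) U

  free : ∀ {U i c} → RowFree U i → ColFree U c → Free U (i , c)
  free rf cf = All.zipWith (λ (a , b) → a , b) (rf , cf)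

  module _ (m : ℕ) where

    -- The rooks U lie in the rows below tʳ and in the columns c < tᶜ and m + c, c < t.
    record State (tʳ tᶜ t : ℕ) (U : List Cell) (r b : ℕ) : Set where
      field
        rows<  : All (λ y → proj₁ y < tʳ) U
        cols   : All (λ y → proj₂ y < tᶜ ⊎ (m ≤ proj₂ y × proj₂ y < m + t)) U
        rowTally : tally (rowFree? U) tʳ ≡ r
        colTally : tally (λ c → colFree? U (m + c)) t ≡ b

    open State

    row-fresh : ∀ {tʳ tᶜ t U r b} → State tʳ tᶜ t U r b → RowFree U tʳ
    row-fresh s = All.map (λ y<t t≡y → ℕ.<⇒≢ y<t (sym t≡y)) (rows< s)

    highCol-fresh : ∀ {tʳ tᶜ t U r b} → tᶜ ≤ m → State tʳ tᶜ t U r b → ColFree U (m + t)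
    highCol-fresh tᶜ≤m s = All.map
      [ (λ y<t eq → ℕ.<⇒≢ (ℕ.<-≤-trans y<t (ℕ.≤-trans tᶜ≤m (ℕ.m≤m+n m _))) (sym eq))
      , (λ (_ , y<) eq → ℕ.<⇒≢ y< (sym eq)) ]′ (cols s)

    lowCol-fresh : ∀ {tʳ tᶜ t U r b} → tᶜ < m → State tʳ tᶜ t U r b → ColFree U tᶜ
    lowCol-fresh tᶜ<m s = All.map
      [ (λ y<t eq → ℕ.<⇒≢ y<t (sym eq)) , (λ (m≤y , _) eq → ℕ.<⇒≢ (ℕ.<-≤-trans tᶜ<m m≤y) eq) ]′ (cols s)

    module _ {t : ℕ} {U : List Cell} {r b : ℕ} (t<m : t < m) where

      -- Row t and column m + t enter the tallies at this step and are still free.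
      skipRow : State t t t U r b → State (suc t) t (suc t) U (suc r) (suc b)
      skipRow s .rows<    = All.map ℕ.m<n⇒m<1+n (rows< s)
      skipRow s .cols     =
        All.map [ inj₁ , (λ (m≤y , y<) → inj₂ (m≤y , ℕ.<-≤-trans y< (ℕ.+-monoʳ-≤ m (ℕ.n≤1+n t)))) ]′ (cols s)
      skipRow s .rowTally = trans (tally-accept (rowFree? U) (row-fresh s)) (cong suc (rowTally s))
      skipRow s .colTally =
        trans (tally-accept (λ c → colFree? U (m + c)) (highCol-fresh (ℕ.<⇒≤ t<m) s)) (cong suc (colTally s))

      -- The new row t is taken at once, and the new free column m + t makes up for the loss of m +
      -- c; hence neither tally changes.
      fillRow : ∀ {c} → c < t → ColFree U (m + c) → State t t t U r b → State (suc t) t (suc t) ((t , m + c) ∷ U) r b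
      fillRow c<t cf s .rows< = ℕ.≤-refl ∷ All.map ℕ.m<n⇒m<1+n (rows< s)
      fillRow {c} c<t cf s .cols =
        inj₂ (ℕ.m≤m+n m c , ℕ.+-monoʳ-< m (ℕ.m<n⇒m<1+n c<t)) ∷ cols (skipRow s)
      fillRow {c} c<t cf s .rowTally = begin
        tally (rowFree? ((t , m + c) ∷ U)) (suc t)
          ≡⟨ tally-reject (rowFree? ((t , m + c) ∷ U)) (λ { (t≢t ∷ _) → t≢t refl }) ⟩
        tally (rowFree? ((t , m + c) ∷ U)) t
          ≡⟨ tally-cong (rowFree? ((t , m + c) ∷ U)) (rowFree? U) t (λ _ → All.tail) (λ j<t rf → ℕ.<⇒≢ j<t ∷ rf) ⟩
        tally (rowFree? U) t                        ≡⟨ rowTally s ⟩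
        r                                           ∎
        where open ≡-Reasoning
      fillRow {c} c<t cf s .colTally = begin
        tally new? (suc t)
          ≡⟨ tally-accept new? ((λ eq → ℕ.<⇒≢ c<t (sym (ℕ.+-cancelˡ-≡ m t c eq))) ∷ highCol-fresh (ℕ.<⇒≤ t<m) s) ⟩
        suc (tally new? t)
          ≡⟨ tally-remove (λ c → colFree? U (m + c)) new? t c<t cf (λ { (c≢c ∷ _) → c≢c refl })
                                   (λ {j} cfj j≢c → (λ eq → j≢c (ℕ.+-cancelˡ-≡ m j c eq)) ∷ cfj) All.tail ⟨
        tally (λ c → colFree? U (m + c)) t ≡⟨ colTally s ⟩
        b                     ∎
        where
        open ≡-Reasoning
        new? : Decidable (λ c′ → ColFree ((t , m + c) ∷ U) (m + c′))
        new? c′ = colFree? ((t , m + c) ∷ U) (m + c′)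

      skipCol : State (suc t) t (suc t) U r b → State (suc t) (suc t) (suc t) U r b
      skipCol s .rows<    = rows< s
      skipCol s .cols     = All.map [ inj₁ ∘ ℕ.m<n⇒m<1+n , inj₂ ]′ (cols s)
      skipCol s .rowTally = rowTally s
      skipCol s .colTally = colTally s

      -- Columns below m are not tallied, so this rook costs one free row and nothing else.
      fillCol : ∀ {i} → i < suc t → RowFree U i → State (suc t) t (suc t) U r b →
        State (suc t) (suc t) (suc t) ((i , t) ∷ U) (pred r) b
      fillCol i≤t rf s .rows<    = i≤t ∷ rows< s
      fillCol i≤t rf s .cols     = inj₁ ℕ.≤-refl ∷ cols (skipCol s)
      fillCol {i} i≤t rf s .rowTally = cong pred (trans
        (sym (tally-remove (rowFree? U) (rowFree? ((i , t) ∷ U)) (suc t) i≤t rf (λ { (i≢i ∷ _) → i≢i refl })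
          (λ rfj j≢i → j≢i ∷ rfj) All.tail))
        (rowTally s))
      fillCol {i} i≤t rf s .colTally = trans
        (tally-cong (λ c → colFree? ((i , t) ∷ U) (m + c)) (λ c → colFree? U (m + c)) (suc t)
          (λ _ → All.tail) (λ _ cf → (λ eq → ℕ.<⇒≢ (ℕ.<-≤-trans t<m (ℕ.m≤m+n m _)) (sym eq)) ∷ cf))
        (colTally s)

    -- The rooks so far matter only through the tallies r and b: all free cells of a group lead to
    -- the same tallies, which is the uniformity that `count-group` asks for.
    count-board : ∀ n {t U r b} k → n + t ≡ m → State t t t U r b →
      count U (board m n t) k ≡ completions n r b k
    count-col : ∀ n {t U r b} k → suc n + t ≡ m → State (suc t) t (suc t) U r b →
      count U (colGroup t ++ board m n (suc t)) k ≡ completionsFromCol n r b k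
    count-board n       zero    eq s = refl
    count-board zero    (suc k) eq s = refl
    count-board (suc n) {t} {U} {r} {b} (suc k) eq s = begin
      count U (rowGroup m t ++ rest) (suc k)
        ≡⟨ count-group (λ c → t , m + c) (λ _ _ (t≢t , _) → t≢t refl) U rest k (completionsFromCol n r b k) (downFrom t)
             (λ c c∈ fc → count-col n k eq (fillRow t<m (∈-downFrom⁻ c∈) (All.map proj₂ fc) s)) ⟩
      count U rest (suc k) + tally (λ c → free? U (t , m + c)) t * completionsFromCol n r b k
        ≡⟨ cong₂ (λ x y → x + y * completionsFromCol n r b k) (count-col n (suc k) eq (skipRow t<m s))
             (trans (tally-cong (λ c → free? U (t , m + c)) (λ c → colFree? U (m + c)) t (λ _ → All.map proj₂) (λ _ → free (row-fresh s)))
                    (colTally s)) ⟩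
      completionsFromCol n (suc r) (suc b) (suc k) + b * completionsFromCol n r b k ∎
      where
      open ≡-Reasoning
      rest = colGroup t ++ board m n (suc t)
      t<m : t < m
      t<m = subst (t <_) eq (s≤s (ℕ.m≤n+m t n))
    count-col n zero eq s = refl
    count-col n {t} {U} {r} {b} (suc k) eq s = begin
      count U (colGroup t ++ rest) (suc k)
        ≡⟨ count-group (_, t) (λ _ _ (_ , t≢t) → t≢t refl) U rest k (completions n (pred r) b k) (downFrom (suc t))
             (λ i i∈ fi → count-board n k eq′ (fillCol t<m (∈-downFrom⁻ i∈) (All.map proj₁ fi) s)) ⟩
      count U rest (suc k) + tally (λ i → free? U (i , t)) (suc t) * completions n (pred r) b k
        ≡⟨ cong₂ (λ x y → x + y * completions n (pred r) b k) (count-board n (suc k) eq′ (skipCol t<m s))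
             (trans (tally-cong (λ i → free? U (i , t)) (rowFree? U) (suc t) (λ _ → All.map proj₁) (λ _ rf → free rf (lowCol-fresh t<m s)))
                    (rowTally s)) ⟩
      completions n r b (suc k) + r * completions n (pred r) b k ∎
      where
      open ≡-Reasoning
      rest = board m n (suc t)
      t<m : t < m
      t<m = subst (t <_) eq (s≤s (ℕ.m≤n+m t n))
      eq′ : n + suc t ≡ m
      eq′ = trans (ℕ.+-suc n t) eq

    count-fullBoard : ∀ k → count [] (board m m 0) k ≡ completions m 0 0 k
    count-fullBoard k = count-board m k (ℕ.+-identityʳ m)
      record { rows< = [] ; cols = [] ; rowTally = refl ; colTally = refl }

    -- The set of cells of the board

    InBoard : Cell → Set
    InBoard (i , c) = i < m × i ≤ c × c < i + m

    ∈-board⇒InBoard : ∀ n t {x} → n + t ≡ m → x ∈ˡ board m n t → InBoard x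
    ∈-board⇒InBoard (suc n) t eq x∈ with ∈-++⁻ (rowGroup m t) x∈
    ... | inj₁ x∈row with c , c∈ , refl ← ∈-map⁻ (λ c → t , m + c) x∈row =
      t<m , ℕ.≤-trans (ℕ.<⇒≤ t<m) (ℕ.m≤m+n m c) , subst (m + c <_) (ℕ.+-comm m t) (ℕ.+-monoʳ-< m (∈-downFrom⁻ c∈))
      where
      t<m : t < m
      t<m = subst (t <_) eq (s≤s (ℕ.m≤n+m t n))
    ... | inj₂ x∈rest with ∈-++⁻ (colGroup t) x∈rest
    ... | inj₂ x∈board = ∈-board⇒InBoard n (suc t) (trans (ℕ.+-suc n t) eq) x∈board
    ... | inj₁ x∈col with i , i∈ , refl ← ∈-map⁻ (_, t) x∈col =
      ℕ.≤-<-trans i≤t t<m , i≤t , ℕ.<-≤-trans t<m (ℕ.m≤n+m m i)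
      where
      i≤t = ℕ.s≤s⁻¹ (∈-downFrom⁻ i∈)
      t<m : t < m
      t<m = subst (t <_) eq (s≤s (ℕ.m≤n+m t n))

    group⊆board : ∀ n t s {x} → t ≤ s → s < n + t → x ∈ˡ rowGroup m s ⊎ x ∈ˡ colGroup s → x ∈ˡ board m n t
    group⊆board zero    t s t≤s s<t x∈ = contradiction s<t (ℕ.≤⇒≯ t≤s)
    group⊆board (suc n) t s t≤s s<  x∈ with t ℕ.≟ s
    ... | yes refl = [ ∈-++⁺ˡ , ∈-++⁺ʳ (rowGroup m t) ∘ ∈-++⁺ˡ ]′ x∈
    ... | no  t≢s  = ∈-++⁺ʳ (rowGroup m t) (∈-++⁺ʳ (colGroup t)
      (group⊆board n (suc t) s (ℕ.≤∧≢⇒< t≤s t≢s) (subst (s <_) (sym (ℕ.+-suc n t)) s<) x∈))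

    InBoard⇒∈-board : ∀ {x} → InBoard x → x ∈ˡ board m m 0
    InBoard⇒∈-board {i , c} (i<m , i≤c , c<i+m) with c ℕ.<? m
    ... | yes c<m = group⊆board m 0 c z≤n (subst (c <_) (sym (ℕ.+-identityʳ m)) c<m)
                      (inj₂ (∈-map⁺ (_, c) (∈-downFrom⁺ (s≤s i≤c))))
    ... | no  c≮m with d , refl ← ℕ.m≤n⇒∃[o]m+o≡n (ℕ.≮⇒≥ c≮m) =
      group⊆board m 0 i z≤n (subst (i <_) (sym (ℕ.+-identityʳ m)) i<m)
        (inj₁ (∈-map⁺ (λ c → i , m + c) (∈-downFrom⁺ (ℕ.+-cancelˡ-< m d i (subst (m + d <_) (ℕ.+-comm i m) c<i+m)))))

    -- The step of a cell can be read off: it is the row if the column is at least m, and the column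
    -- otherwise. This separates the groups of different steps in `board-unique`.
    ∈-board⇒late : ∀ n t {x} → n + t ≡ m → x ∈ˡ board m n t →
      (m ≤ proj₂ x × t ≤ proj₁ x) ⊎ (t ≤ proj₂ x × proj₂ x < m)
    ∈-board⇒late (suc n) t eq x∈ with ∈-++⁻ (rowGroup m t) x∈
    ... | inj₁ x∈row with c , _ , refl ← ∈-map⁻ (λ c → t , m + c) x∈row = inj₁ (ℕ.m≤m+n m c , ℕ.≤-refl)
    ... | inj₂ x∈rest with ∈-++⁻ (colGroup t) x∈rest
    ... | inj₁ x∈col with i , _ , refl ← ∈-map⁻ (_, t) x∈col =
      inj₂ (ℕ.≤-refl , subst (t <_) eq (s≤s (ℕ.m≤n+m t n)))
    ... | inj₂ x∈board with ∈-board⇒late n (suc t) (trans (ℕ.+-suc n t) eq) x∈board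
    ... | inj₁ (m≤c , t<i) = inj₁ (m≤c , ℕ.<⇒≤ t<i)
    ... | inj₂ (t<c , c<m) = inj₂ (ℕ.<⇒≤ t<c , c<m)

    board-unique : ∀ n t → n + t ≡ m → Unique (board m n t)
    board-unique zero    t eq = []
    board-unique (suc n) t eq =
      Unique.++⁺ (Unique.map⁺ (λ e → ℕ.+-cancelˡ-≡ m _ _ (,-injectiveʳ e)) (Unique.downFrom⁺ t))
        (Unique.++⁺ (Unique.map⁺ ,-injectiveˡ (Unique.downFrom⁺ (suc t))) (board-unique n (suc t) eq′) col-disjoint)
        row-disjoint
      where
      eq′ : n + suc t ≡ m
      eq′ = trans (ℕ.+-suc n t) eq
      t<m : t < m
      t<m = subst (t <_) eq (s≤s (ℕ.m≤n+m t n))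
      col-disjoint : ∀ {x} → ¬ (x ∈ˡ colGroup t × x ∈ˡ board m n (suc t))
      col-disjoint (x∈col , x∈board) with i , _ , refl ← ∈-map⁻ (_, t) x∈col | ∈-board⇒late n (suc t) eq′ x∈board
      ... | inj₁ (m≤t , _) = ℕ.<⇒≱ t<m m≤t
      ... | inj₂ (t<t , _) = ℕ.<-irrefl refl t<t
      row-disjoint : ∀ {x} → ¬ (x ∈ˡ rowGroup m t × x ∈ˡ (colGroup t ++ board m n (suc t)))
      row-disjoint (x∈row , x∈rest) with c , _ , refl ← ∈-map⁻ (λ c → t , m + c) x∈row | ∈-++⁻ (colGroup t) x∈rest
      ... | inj₁ x∈col with i , _ , e ← ∈-map⁻ (_, t) x∈col =
        ℕ.<⇒≱ t<m (subst (m ≤_) (,-injectiveʳ e) (ℕ.m≤m+n m c))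
      ... | inj₂ x∈board with ∈-board⇒late n (suc t) eq′ x∈board
      ... | inj₁ (_ , t<t) = ℕ.<-irrefl refl t<t
      ... | inj₂ (_ , m+c<m) = ℕ.<⇒≱ m+c<m (ℕ.m≤m+n m c)

    -- Squares of the grid as cells of the board

    toCell : Fin m × Fin m → Cell
    toCell (i , j) = toℕ i , toℕ i + toℕ (opposite j)

    cell : Fin (m * m) → Cell
    cell = toCell ∘ remQuot m

    cell-combine : ∀ i j → cell (combine i j) ≡ toCell (i , j)
    cell-combine i j = cong toCell (Fin.remQuot-combine i j)

    toCell-injective : ∀ {x y} → toCell x ≡ toCell y → x ≡ y
    toCell-injective {i , j} {i′ , j′} eq with Fin.toℕ-injective (,-injectiveˡ eq)
    ... | refl = cong (i ,_) (begin
      j                         ≡⟨ Fin.opposite-involutive j ⟨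
      opposite (opposite j)
        ≡⟨ cong opposite (Fin.toℕ-injective (ℕ.+-cancelˡ-≡ (toℕ i) _ _ (,-injectiveʳ eq))) ⟩
      opposite (opposite j′)    ≡⟨ Fin.opposite-involutive j′ ⟩
      j′                        ∎)
      where open ≡-Reasoning

    cell-injective : ∀ {x y} → cell x ≡ cell y → x ≡ y
    cell-injective {x} {y} eq = begin
      x                                       ≡⟨ Fin.combine-remQuot {m} m x ⟨
      _                                       ≡⟨ cong (λ (i , j) → combine i j) (toCell-injective eq) ⟩
      _                                       ≡⟨ Fin.combine-remQuot {m} m y ⟩
      y                                       ∎
      where open ≡-Reasoning

    cell-InBoard : ∀ x → InBoard (cell x)
    cell-InBoard x = let (i , j) = remQuot {m} m x in
      Fin.toℕ<n i , ℕ.m≤m+n (toℕ i) _ , ℕ.+-monoʳ-< (toℕ i) (Fin.toℕ<n (opposite j))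

    InBoard⇒∈-cells : ∀ {x} → InBoard x → x ∈ˡ tabulate cell
    InBoard⇒∈-cells {i , c} (i<m , i≤c , c<i+m) with e , refl ← ℕ.m≤n⇒∃[o]m+o≡n i≤c =
      subst (_∈ˡ tabulate cell) (trans (cell-combine (fromℕ< i<m) (opposite (fromℕ< e<m))) eq)
        (∈-tabulate⁺ (combine (fromℕ< i<m) (opposite (fromℕ< e<m))))
      where
      e<m = ℕ.+-cancelˡ-< i e m c<i+m
      eq : toCell (fromℕ< i<m , opposite (fromℕ< e<m)) ≡ (i , i + e)
      eq rewrite Fin.opposite-involutive (fromℕ< e<m) | Fin.toℕ-fromℕ< i<m | Fin.toℕ-fromℕ< e<m = refl

    -- Both lists are free of repetitions and consist of the cells in `InBoard`, so they agree as
    -- bags.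
    cells↭board : tabulate cell ↭ board m m 0
    cells↭board = ∼bag⇒↭ (unique∧set⇒bag (Unique.tabulate⁺ cell-injective) (board-unique m 0 (ℕ.+-identityʳ m))
      (mk⇔ (λ x∈ → let (y , eq) = ∈-tabulate⁻ x∈ in InBoard⇒∈-board (subst InBoard (sym eq) (cell-InBoard y)))
           (InBoard⇒∈-cells ∘ ∈-board⇒InBoard m 0 (ℕ.+-identityʳ m))))

    -- The column i + (m - 1 - j) is the diagonal i - j shifted by the constant m - 1, so equal
    -- columns are equal diagonals. The `suc` turns the shift into m.
    diagonal : ∀ i j → ℤ.+ suc (proj₂ (toCell (i , j))) ≡ coord i ℤ.- coord j ℤ.+ ℤ.+ m
    diagonal i j = begin
      ℤ.+ suc (toℕ i + o)                       ≡⟨ identity (ℤ.+ toℕ i) (ℤ.+ toℕ j) (ℤ.+ o) ⟩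
      coord i ℤ.- coord j ℤ.+ ℤ.+ (o + suc (toℕ j)) ≡⟨ cong (λ x → coord i ℤ.- coord j ℤ.+ ℤ.+ x) complement ⟩
      coord i ℤ.- coord j ℤ.+ ℤ.+ m             ∎
      where
      open ≡-Reasoning
      o = toℕ (opposite j)
      identity : ∀ i j o → ℤ.1ℤ ℤ.+ (i ℤ.+ o) ≡ (ℤ.1ℤ ℤ.+ i) ℤ.- (ℤ.1ℤ ℤ.+ j) ℤ.+ (o ℤ.+ (ℤ.1ℤ ℤ.+ j))
      identity = ℤ-Solver.solve-∀
      complement : o + suc (toℕ j) ≡ m
      complement = trans (cong (_+ suc (toℕ j)) (Fin.opposite-prop j)) (ℕ.m∸n+n≡m (Fin.toℕ<n j))

    Attack : Fin m × Fin m → Fin m × Fin m → Set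
    Attack (i , j) (i′ , j′) = coord i ≡ coord i′ ⊎ coord i ℤ.- coord j ≡ coord i′ ℤ.- coord j′

    ¬Attack⇒Compatible : ∀ x y → ¬ Attack x y → Compatible (toCell x) (toCell y)
    ¬Attack⇒Compatible (i , j) (i′ , j′) ¬a =
      (λ eq → ¬a (inj₁ (cong (ℤ.+_ ∘ suc) eq))) ,
      (λ eq → ¬a (inj₂ (∙-cancelʳ (ℤ.+ m) _ _
        (trans (sym (diagonal i j)) (trans (cong (ℤ.+_ ∘ suc) eq) (diagonal i′ j′))))))

    Compatible⇒¬Attack : ∀ x y → Compatible (toCell x) (toCell y) → ¬ Attack x y
    Compatible⇒¬Attack (i , j) (i′ , j′) (i≢ , _) (inj₁ eq) = i≢ (ℕ.suc-injective (ℤ.+-injective eq))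
    Compatible⇒¬Attack (i , j) (i′ , j′) (_ , c≢) (inj₂ eq) = c≢ (ℕ.suc-injective (ℤ.+-injective
      (trans (diagonal i j) (trans (cong (ℤ._+ ℤ.+ m) eq) (sym (diagonal i′ j′))))))

    NonAttacking⇒Extends : ∀ {s} → NonAttacking m s → Extends [] cell s
    NonAttacking⇒Extends {s} na = (λ _ → []) , λ {x} {y} x∈ y∈ x≢y →
      ¬Attack⇒Compatible (remQuot m x) (remQuot m y)
        (na _ _ _ _ (subst (_∈ s) (sym (Fin.combine-remQuot {m} m x)) x∈) (subst (_∈ s) (sym (Fin.combine-remQuot {m} m y)) y∈)
          (x≢y ∘ cell-injective ∘ cong toCell))

    Extends⇒NonAttacking : ∀ {s} → Extends [] cell s → NonAttacking m s
    Extends⇒NonAttacking (_ , compat) i j i′ j′ ij∈ ij′∈ ij≢ = Compatible⇒¬Attack (i , j) (i′ , j′)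
      (subst₂ Compatible (cell-combine i j) (cell-combine i′ j′)
        (compat ij∈ ij′∈ λ eq → let (p , q) = Fin.combine-injective i j i′ j′ eq in ij≢ (cong₂ _,_ p q)))

  A-S≡completions : ∀ m k → A-S m k ≡ completions m 0 0 k
  A-S≡completions m k = begin
    A-S m k                          ≡⟨ count-subsets (m * m) [] (cell m) k _
                                          ( (λ (size , na) → size , NonAttacking⇒Extends m na)
                                          , (λ (size , ext) → size , Extends⇒NonAttacking m ext) ) ⟩
    count [] (tabulate (cell m)) k   ≡⟨ count-↭ʳ (cells↭board m) [] k ⟩
    count [] (board m m 0) k         ≡⟨ count-fullBoard m k ⟩
    completions m 0 0 k                        ∎
    where open ≡-Reasoning

open Placements using (completions; completionsFromCol; A-S≡completions)

open import Data.Bool using (if_then_else_)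
open import Data.Integer as ℤ using (ℤ; -[1+_]; 0ℤ; -_; _≟_)
import Data.Integer.Properties as ℤ
open import Data.Integer.Tactic.RingSolver using (solve-∀)
open import Data.List using (foldr; applyUpTo)
open import Data.List.Properties using (map-upTo)
open import Data.Nat as ℕ using (zero; suc; _!; NonZero; ⌊_/2⌋; s≤s)
open import Data.Nat.Combinatorics using (_C_; nCk+nC[k+1]≡[n+1]C[k+1]; k>n⇒nCk≡0)
import Data.Nat.Properties as ℕ
open import Data.Product using (_,_)
open import Data.Rational using (ℚ; 0ℚ; toℚᵘ)
import Data.Rational.Properties as ℚ
open import Data.Rational.Unnormalised using (mkℚᵘ; *≡*)
import Data.Rational.Unnormalised.Properties as ℚᵘ
open import Function using (_∘_)
open import Relation.Binary.PropositionalEquality hiding (_≡_)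
open import Relation.Nullary using (does; yes; no; contradiction)
open import Data.Nat using (ℕ; ⌈_/2⌉)
open import Data.Integer using (+_; _+_; _-_; _*_; 1ℤ)
open import Data.Rational using (_/_) renaming (_+_ to _+ℚ_; _*_ to _*ℚ_)
open import Relation.Binary.PropositionalEquality using (_≡_)

-- Steps as operators on functions of the state

-- Each operator sums φ over the outcomes of a choice made in the state (r, b); in a composition the
-- outermost choice therefore comes first. Thus `insertMax` makes the postponed column choice before
-- the row choice.
colStep rowStep insertMax : (ℤ → ℤ → ℤ) → ℤ → ℤ → ℤ
colStep φ r b = φ r b + r * φ (r - 1ℤ) b
rowStep φ r b = φ (r + 1ℤ) (b + 1ℤ) + b * φ r b
insertMax φ = colStep (rowStep φ)

-- z counts the free columns c < m: seen from the smallest index, they play the part of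
-- the columns m + c.
insertMin : ℤ → (ℤ → ℤ → ℤ) → ℤ → ℤ → ℤ
insertMin t φ r b = φ (r + 1ℤ) (b + 1ℤ) + r * φ r b + z * (φ r (b + 1ℤ) + r * φ (r - 1ℤ) b)
  where z = t + r - b

up-down : ∀ r → r + 1ℤ - 1ℤ ≡ r
up-down = solve-∀

down-up : ∀ r → r - 1ℤ + 1ℤ ≡ r
down-up = solve-∀

-- A new largest and a new smallest index can be inserted in either order. Once the largest is
-- there, the smallest joins t + 1 indices instead of t, whence the shifted parameter.
insertMax-insertMin : ∀ t φ r b → insertMax (insertMin (t + 1ℤ) φ) r b ≡ insertMin t (insertMax φ) r b
-- Arguments of φ that differ by cancelling shifts are identified; the nine values of φ that remain
-- are variables of one polynomial identity.
insertMax-insertMin t φ r b rewrite up-down r | down-up r | down-up (r - 1ℤ) =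
  identity t r b (φ (r + 1ℤ + 1ℤ) (b + 1ℤ + 1ℤ)) (φ (r + 1ℤ) (b + 1ℤ + 1ℤ)) (φ (r + 1ℤ) (b + 1ℤ))
    (φ r (b + 1ℤ)) (φ r b) (φ r (b + 1ℤ + 1ℤ)) (φ (r - 1ℤ) b) (φ (r - 1ℤ) (b + 1ℤ)) (φ (r - 1ℤ - 1ℤ) b)
  where
  identity : ∀ t r b f₂₂ f₁₂ f₁₁ f₀₁ f₀₀ f₀₂ g₀ g₁ h₀ →
    f₂₂ + (r + 1ℤ) * f₁₁ + (t + 1ℤ + (r + 1ℤ) - (b + 1ℤ)) * (f₁₂ + (r + 1ℤ) * f₀₁)
      + b * (f₁₁ + r * f₀₀ + (t + 1ℤ + r - b) * (f₀₁ + r * g₀))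
      + r * (f₁₂ + r * f₀₁ + (t + 1ℤ + r - (b + 1ℤ)) * (f₀₂ + r * g₁)
             + b * (f₀₁ + (r - 1ℤ) * g₀ + (t + 1ℤ + (r - 1ℤ) - b) * (g₁ + (r - 1ℤ) * h₀)))
    ≡ f₂₂ + (b + 1ℤ) * f₁₁ + (r + 1ℤ) * (f₁₂ + (b + 1ℤ) * f₀₁)
      + r * (f₁₁ + b * f₀₀ + r * (f₀₁ + b * g₀))
      + (t + r - b) * (f₁₂ + (b + 1ℤ) * f₀₁ + r * (f₀₂ + (b + 1ℤ) * g₁)
                       + r * (f₀₁ + b * g₀ + (r - 1ℤ) * (g₁ + b * h₀)))
  identity = solve-∀

-- The sum of φ r b over all placements obtained by t insertions.
total : ℕ → (ℤ → ℤ → ℤ) → ℤ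
total zero    φ = φ 0ℤ 0ℤ
total (suc t) φ = total t (insertMax φ)

_≗₂_ : (φ χ : ℤ → ℤ → ℤ) → Set
φ ≗₂ χ = ∀ r b → φ r b ≡ χ r b

colStep-cong : ∀ {φ χ} → φ ≗₂ χ → colStep φ ≗₂ colStep χ
colStep-cong p r b = cong₂ _+_ (p r b) (cong (r *_) (p _ _))

rowStep-cong : ∀ {φ χ} → φ ≗₂ χ → rowStep φ ≗₂ rowStep χ
rowStep-cong p r b = cong₂ _+_ (p _ _) (cong (b *_) (p r b))

total-cong : ∀ t {φ χ} → φ ≗₂ χ → total t φ ≡ total t χ
total-cong zero    p = p 0ℤ 0ℤ
total-cong (suc t) p = total-cong t (colStep-cong (rowStep-cong p))

total-+ : ∀ t φ χ → total t (λ r b → φ r b + χ r b) ≡ total t φ + total t χ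
total-+ zero    φ χ = refl
total-+ (suc t) φ χ = trans (total-cong t λ r b → identity r b
    (φ (r + 1ℤ) (b + 1ℤ)) (χ (r + 1ℤ) (b + 1ℤ)) (φ r b) (χ r b)
    (φ (r - 1ℤ + 1ℤ) (b + 1ℤ)) (χ (r - 1ℤ + 1ℤ) (b + 1ℤ)) (φ (r - 1ℤ) b) (χ (r - 1ℤ) b))
  (total-+ t (insertMax φ) (insertMax χ))
  where
  identity : ∀ r b f₁ g₁ f₂ g₂ f₃ g₃ f₄ g₄ →
    f₁ + g₁ + b * (f₂ + g₂) + r * (f₃ + g₃ + b * (f₄ + g₄))
    ≡ f₁ + b * f₂ + r * (f₃ + b * f₄) + (g₁ + b * g₂ + r * (g₃ + b * g₄))
  identity = solve-∀

+suc : ∀ n → + suc n ≡ + n + 1ℤ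
+suc n = ℤ.+-comm 1ℤ (+ n)

-- Commutation moves the insertion of the smallest index to the front. There it meets the empty
-- configuration, in which smallest and largest are the same.
total-insertMin : ∀ t φ → total t (insertMin (+ t) φ) ≡ total t (insertMax φ)
total-insertMin zero φ = refl
total-insertMin (suc t) φ = begin
  total t (insertMax (insertMin (+ suc t) φ))    ≡⟨ cong (λ u → total t (insertMax (insertMin u φ))) (+suc t) ⟩
  total t (insertMax (insertMin (+ t + 1ℤ) φ))   ≡⟨ total-cong t (insertMax-insertMin (+ t) φ) ⟩
  total t (insertMin (+ t) (insertMax φ))        ≡⟨ total-insertMin t (insertMax φ) ⟩
  total t (insertMax (insertMax φ))               ∎
  where open ≡-Reasoning

-- Averaging the two insertions

lift : (ℤ → ℤ) → ℤ → ℤ → ℤ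
lift ψ r _ = ψ r

-- The sum of `insertMax` and `insertMin` on functions of r, not yet halved: 3r + t is r from each
-- insertion plus b + z = t + r.
symmetrizedStep : ℤ → (ℤ → ℤ) → ℤ → ℤ
symmetrizedStep t ψ r = + 2 * ψ (r + 1ℤ) + (+ 3 * r + t) * ψ r + r * (r + t) * ψ (r - 1ℤ)

-- Both insertions have the same total, by `total-insertMin`. The factor 2 replaces the division in
-- the average and keeps all values integral.
total-step : ∀ t ψ → + 2 * total (suc t) (lift ψ) ≡ total t (lift (symmetrizedStep (+ t) ψ))
total-step t ψ = begin
  + 2 * total t (insertMax (lift ψ))                            ≡⟨ double (total t (insertMax (lift ψ))) ⟩
  total t (insertMax (lift ψ)) + total t (insertMax (lift ψ))
    ≡⟨ cong (_+_ (total t (insertMax (lift ψ)))) (total-insertMin t (lift ψ)) ⟨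
  total t (insertMax (lift ψ)) + total t (insertMin (+ t) (lift ψ))
    ≡⟨ total-+ t (insertMax (lift ψ)) (insertMin (+ t) (lift ψ)) ⟨
  total t (λ r b → insertMax (lift ψ) r b + insertMin (+ t) (lift ψ) r b) ≡⟨ total-cong t pointwise ⟩
  total t (lift (symmetrizedStep (+ t) ψ))                            ∎
  where
  open ≡-Reasoning
  double : ∀ x → + 2 * x ≡ x + x
  double = solve-∀
  identity : ∀ t r b f₁ f₀ g →
    f₁ + b * f₀ + r * (f₀ + b * g) + (f₁ + r * f₀ + (t + r - b) * (f₀ + r * g))
    ≡ + 2 * f₁ + (+ 3 * r + t) * f₀ + r * (r + t) * g
  identity = solve-∀
  pointwise : ∀ r b → insertMax (lift ψ) r b + insertMin (+ t) (lift ψ) r b ≡ symmetrizedStep (+ t) ψ r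
  pointwise r b rewrite down-up r = identity (+ t) r b (ψ (r + 1ℤ)) (ψ r) (ψ (r - 1ℤ))

-- Powers of 2 + D and the symmetrized step

2+D : (ℤ → ℤ) → ℤ → ℤ
2+D ψ r = + 2 * ψ r + r * ψ (r - 1ℤ)

[2+D]^ : ℕ → (ℤ → ℤ) → ℤ → ℤ
[2+D]^ zero    ψ = ψ
[2+D]^ (suc l) ψ = 2+D ([2+D]^ l ψ)

-- `symmetrizedStep t` is affine in t with slope 1 + D. The slope is written as (2 + D) - 1, so that
-- it passes through the powers of 2 + D.
symmetrizedStep-shift : ∀ l t s ψ n →
  [2+D]^ l (symmetrizedStep (t + s) ψ) n ≡ [2+D]^ l (symmetrizedStep t ψ) n + s * ([2+D]^ (suc l) ψ n - [2+D]^ l ψ n)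
symmetrizedStep-shift zero t s ψ n = identity t s n (ψ (n + 1ℤ)) (ψ n) (ψ (n - 1ℤ))
  where
  identity : ∀ t s n f₁ f₀ g →
    + 2 * f₁ + (+ 3 * n + (t + s)) * f₀ + n * (n + (t + s)) * g
    ≡ + 2 * f₁ + (+ 3 * n + t) * f₀ + n * (n + t) * g + s * (+ 2 * f₀ + n * g - f₀)
  identity = solve-∀
symmetrizedStep-shift (suc l) t s ψ n =
  trans (cong₂ (λ u v → + 2 * u + n * v) (symmetrizedStep-shift l t s ψ n) (symmetrizedStep-shift l t s ψ (n - 1ℤ)))
        (identity s n ([2+D]^ l (symmetrizedStep t ψ) n) ([2+D]^ (suc l) ψ n) ([2+D]^ l ψ n)
          ([2+D]^ l (symmetrizedStep t ψ) (n - 1ℤ)) ([2+D]^ (suc l) ψ (n - 1ℤ)) ([2+D]^ l ψ (n - 1ℤ)))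
  where
  identity : ∀ s n x y w x′ y′ w′ →
    + 2 * (x + s * (y - w)) + n * (x′ + s * (y′ - w′))
    ≡ + 2 * x + n * x′ + s * (+ 2 * y + n * y′ - (+ 2 * w + n * w′))
  identity = solve-∀

-- The parameter n + l is the t with n = t - l. At this point the step turns into the two terms of
-- the Stirling recurrence: l grows by one with weight n, or n grows by one with weight 1.
[2+D]^-symmetrizedStep : ∀ l ψ n →
  [2+D]^ l (symmetrizedStep (n + + l) ψ) n ≡ + 2 * (n * [2+D]^ (suc l) ψ n + [2+D]^ l ψ (n + 1ℤ))
[2+D]^-symmetrizedStep zero ψ n = identity n (ψ (n + 1ℤ)) (ψ n) (ψ (n - 1ℤ))
  where
  identity : ∀ n f₁ f₀ g →
    + 2 * f₁ + (+ 3 * n + (n + 0ℤ)) * f₀ + n * (n + (n + 0ℤ)) * g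
    ≡ + 2 * (n * (+ 2 * f₀ + n * g) + f₁)
  identity = solve-∀
[2+D]^-symmetrizedStep (suc l) ψ n = begin
  + 2 * [2+D]^ l (symmetrizedStep (n + + suc l) ψ) n + n * [2+D]^ l (symmetrizedStep (n + + suc l) ψ) (n - 1ℤ)
    -- The induction hypothesis at x has parameter x + l, which n + l + 1 exceeds by 1 for x = n and
    -- by 2 for x = n - 1.
    ≡⟨ cong₂ (λ u v → + 2 * u + n * v) (shifted n 1ℤ (split₁ n (+ l))) (shifted (n - 1ℤ) (+ 2) (split₂ n (+ l))) ⟩
  + 2 * (+ 2 * (n * B + [2+D]^ l ψ (n + 1ℤ)) + 1ℤ * (B - A))
    + n * (+ 2 * ((n - 1ℤ) * [2+D]^ (suc l) ψ (n - 1ℤ) + [2+D]^ l ψ (n - 1ℤ + 1ℤ)) + + 2 * ([2+D]^ (suc l) ψ (n - 1ℤ) - [2+D]^ l ψ (n - 1ℤ)))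
    ≡⟨ cong (λ x → + 2 * (+ 2 * (n * B + [2+D]^ l ψ (n + 1ℤ)) + 1ℤ * (B - A))
              + n * (+ 2 * ((n - 1ℤ) * [2+D]^ (suc l) ψ (n - 1ℤ) + [2+D]^ l ψ x) + + 2 * ([2+D]^ (suc l) ψ (n - 1ℤ) - [2+D]^ l ψ (n - 1ℤ)))) (down-up n) ⟩
  _ ≡⟨ identity n A ([2+D]^ l ψ (n + 1ℤ)) ([2+D]^ l ψ (n - 1ℤ)) ([2+D]^ (suc l) ψ (n - 1ℤ)) ⟩
  + 2 * (n * [2+D]^ (suc (suc l)) ψ n + (+ 2 * [2+D]^ l ψ (n + 1ℤ) + (n + 1ℤ) * A))
    ≡⟨ cong (λ x → + 2 * (n * [2+D]^ (suc (suc l)) ψ n + (+ 2 * [2+D]^ l ψ (n + 1ℤ) + (n + 1ℤ) * [2+D]^ l ψ x))) (up-down n) ⟨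
  + 2 * (n * [2+D]^ (suc (suc l)) ψ n + [2+D]^ (suc l) ψ (n + 1ℤ)) ∎
  where
  open ≡-Reasoning
  A = [2+D]^ l ψ n
  B = [2+D]^ (suc l) ψ n
  split₁ : ∀ n l → n + (1ℤ + l) ≡ n + l + 1ℤ
  split₁ = solve-∀
  split₂ : ∀ n l → n + (1ℤ + l) ≡ n - 1ℤ + l + + 2
  split₂ = solve-∀
  shifted : ∀ x s → n + + suc l ≡ x + + l + s →
    [2+D]^ l (symmetrizedStep (n + + suc l) ψ) x
    ≡ + 2 * (x * [2+D]^ (suc l) ψ x + [2+D]^ l ψ (x + 1ℤ)) + s * ([2+D]^ (suc l) ψ x - [2+D]^ l ψ x)
  shifted x s eq = begin
    [2+D]^ l (symmetrizedStep (n + + suc l) ψ) x       ≡⟨ cong (λ u → [2+D]^ l (symmetrizedStep u ψ) x) eq ⟩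
    [2+D]^ l (symmetrizedStep (x + + l + s) ψ) x       ≡⟨ symmetrizedStep-shift l (x + + l) s ψ x ⟩
    [2+D]^ l (symmetrizedStep (x + + l) ψ) x + s * ([2+D]^ (suc l) ψ x - [2+D]^ l ψ x)
      ≡⟨ cong (_+ s * ([2+D]^ (suc l) ψ x - [2+D]^ l ψ x)) ([2+D]^-symmetrizedStep l ψ x) ⟩
    _ ∎
  identity : ∀ n a a⁺ a⁻ b⁻ →
    + 2 * (+ 2 * (n * (+ 2 * a + n * a⁻) + a⁺) + 1ℤ * (+ 2 * a + n * a⁻ - a))
      + n * (+ 2 * ((n - 1ℤ) * b⁻ + a) + + 2 * (b⁻ - a⁻))
    ≡ + 2 * (n * (+ 2 * (+ 2 * a + n * a⁻) + n * b⁻) + (+ 2 * a⁺ + (n + 1ℤ) * a))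
  identity = solve-∀

-- Evaluation of the total

∑< : ℕ → (ℕ → ℤ) → ℤ
∑< zero    f = 0ℤ
∑< (suc n) f = f 0 + ∑< n (f ∘ suc)

∑<-cong : ∀ n {f g} → (∀ i → f i ≡ g i) → ∑< n f ≡ ∑< n g
∑<-cong zero    p = refl
∑<-cong (suc n) p = cong₂ _+_ (p 0) (∑<-cong n (p ∘ suc))

∑<-+ : ∀ n f g → ∑< n (λ i → f i + g i) ≡ ∑< n f + ∑< n g
∑<-+ zero    f g = refl
∑<-+ (suc n) f g = trans (cong (_+_ (f 0 + g 0)) (∑<-+ n (f ∘ suc) (g ∘ suc))) (interchange (f 0) (g 0) _ _)
  where
  interchange : ∀ a b c d → a + b + (c + d) ≡ a + c + (b + d)
  interchange = solve-∀

∑<-* : ∀ n x f → ∑< n (λ i → x * f i) ≡ x * ∑< n f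
∑<-* zero    x f = sym (ℤ.*-zeroʳ x)
∑<-* (suc n) x f = trans (cong (_+_ (x * f 0)) (∑<-* n x (f ∘ suc))) (factor x (f 0) _)
  where
  factor : ∀ x a b → x * a + x * b ≡ x * (a + b)
  factor = solve-∀

∑<-last : ∀ n f → ∑< (suc n) f ≡ ∑< n f + f n
∑<-last zero    f = ℤ.+-comm (f 0) 0ℤ
∑<-last (suc n) f = trans (cong (_+_ (f 0)) (∑<-last n (f ∘ suc))) (sym (ℤ.+-assoc (f 0) _ _))

∑<-zero : ∀ n {f} → (∀ i → f i ≡ 0ℤ) → ∑< n f ≡ 0ℤ
∑<-zero zero    p = refl
∑<-zero (suc n) p = cong₂ _+_ (p 0) (∑<-zero n (p ∘ suc))

∑<-++ : ∀ n n′ f → ∑< (n ℕ.+ n′) f ≡ ∑< n f + ∑< n′ (f ∘ (n ℕ.+_))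
∑<-++ zero    n′ f = sym (ℤ.+-identityˡ _)
∑<-++ (suc n) n′ f = trans (cong (_+_ (f 0)) (∑<-++ n n′ (f ∘ suc))) (sym (ℤ.+-assoc (f 0) _ _))

-- The Stirling numbers of t over t - l

stirling₂-vanish : ∀ n i → stirling₂ n (suc n ℕ.+ i) ≡ 0
stirling₂-vanish zero    i = refl
stirling₂-vanish (suc n) i
  rewrite sym (ℕ.+-suc n i) | stirling₂-vanish n (suc i) | ℕ.+-suc n i | stirling₂-vanish n i
  = trans (ℕ.+-identityʳ _) (ℕ.*-zeroʳ (n ℕ.+ i))

extStirling₂-neg : ∀ n r → extStirling₂ (+ n) -[1+ r ] ≡ 0
extStirling₂-neg zero    r = refl
extStirling₂-neg (suc n) r = refl

-- The numbers vanish at negative lower arguments, so the recurrence has no boundary case, and l may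
-- exceed t in `coStirling₂`.
extStirling₂-rec : ∀ n x →
  + extStirling₂ (+ suc n) x ≡ x * + extStirling₂ (+ n) x + + extStirling₂ (+ n) (x - 1ℤ)
extStirling₂-rec n (+ zero)   rewrite extStirling₂-neg n 0 = refl
extStirling₂-rec n (+ suc r)  =
  trans (ℤ.pos-+ (suc r ℕ.* stirling₂ n (suc r)) _) (cong (_+ + stirling₂ n r) (ℤ.pos-* (suc r) (stirling₂ n (suc r))))
extStirling₂-rec n (-[1+ r ])
  rewrite extStirling₂-neg n r | extStirling₂-neg n (suc (r ℕ.+ 0)) =
    sym (trans (ℤ.+-identityʳ _) (ℤ.*-zeroʳ -[1+ r ]))

coStirling₂ : ℕ → ℕ → ℤ
coStirling₂ t l = + extStirling₂ (+ t) (+ t - + l)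

coStirling₂-vanish : ∀ t i → coStirling₂ t (suc t ℕ.+ i) ≡ 0ℤ
coStirling₂-vanish t i =
  cong +_ (trans (cong (extStirling₂ (+ t)) (difference (+ t) (+ i))) (extStirling₂-neg t i))
  where
  difference : ∀ t i → t - (1ℤ + (t + i)) ≡ - (1ℤ + i)
  difference = solve-∀

coStirling₂-suc-0 : ∀ t → coStirling₂ (suc t) 0 ≡ coStirling₂ t 0
coStirling₂-suc-0 t rewrite ℕ.+-identityʳ t | sym (ℕ.+-identityʳ (suc t)) | stirling₂-vanish t 0 =
  cong (λ x → + (x ℕ.+ stirling₂ t t)) (ℕ.*-zeroʳ t)

coStirling₂-suc-suc : ∀ t l →
  coStirling₂ (suc t) (suc l) ≡ (+ t - + l) * coStirling₂ t l + coStirling₂ t (suc l)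
coStirling₂-suc-suc t l = begin
  + extStirling₂ (+ suc t) (+ suc t - + suc l)
    ≡⟨ cong (λ x → + extStirling₂ (+ suc t) x) (cancel (+ t) (+ l)) ⟩
  + extStirling₂ (+ suc t) (+ t - + l)          ≡⟨ extStirling₂-rec t (+ t - + l) ⟩
  (+ t - + l) * coStirling₂ t l + + extStirling₂ (+ t) (+ t - + l - 1ℤ)
    ≡⟨ cong (λ x → (+ t - + l) * coStirling₂ t l + + extStirling₂ (+ t) x) (assoc (+ t) (+ l)) ⟩
  (+ t - + l) * coStirling₂ t l + coStirling₂ t (suc l)             ∎
  where
  open ≡-Reasoning
  cancel : ∀ t l → 1ℤ + t - (1ℤ + l) ≡ t - l
  cancel = solve-∀
  assoc : ∀ t l → t - l - 1ℤ ≡ t - (1ℤ + l)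
  assoc = solve-∀

-- L pads the sum with zero terms, so that it can later be cut at k whether or not k exceeds m. The
-- induction applies `[2+D]^-symmetrizedStep` to each term and reassembles the results by the
-- recurrence of `coStirling₂`.
total-closed : ∀ t L ψ → total t (lift ψ) ≡ ∑< (suc t ℕ.+ L) (λ l → coStirling₂ t l * [2+D]^ l ψ (+ t - + l))
total-closed zero    L ψ =
  sym (trans (cong₂ _+_ (ℤ.*-identityˡ (ψ 0ℤ)) (∑<-zero L λ _ → refl)) (ℤ.+-identityʳ (ψ 0ℤ)))
total-closed (suc t) L ψ = ℤ.*-cancelˡ-≡ (+ 2) _ _ (begin
  + 2 * total (suc t) (lift ψ)                          ≡⟨ total-step t ψ ⟩
  total t (lift (symmetrizedStep (+ t) ψ))
    ≡⟨ total-closed t L (symmetrizedStep (+ t) ψ) ⟩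
  ∑< n (λ l → coStirling₂ t l * [2+D]^ l (symmetrizedStep (+ t) ψ) (+ t - + l)) ≡⟨ ∑<-cong n expand ⟩
  ∑< n (λ l → + 2 * (a l + g l))                    ≡⟨ ∑<-* n (+ 2) (λ l → a l + g l) ⟩
  + 2 * ∑< n (λ l → a l + g l)                      ≡⟨ cong (_*_ (+ 2)) (∑<-+ n a g) ⟩
  -- The term `g n` is zero and may be added. Splitting off `g 0` instead then puts `g (suc l)` next
  -- to `a l`: both carry the power l + 1 at the same argument.
  + 2 * (∑< n a + ∑< n g)                           ≡⟨ cong (λ x → + 2 * (∑< n a + x)) last ⟨
  + 2 * (∑< n a + (g 0 + ∑< n (g ∘ suc)))           ≡⟨ cong (_*_ (+ 2)) (exchange (∑< n a) (g 0) _) ⟩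
  + 2 * (g 0 + (∑< n a + ∑< n (g ∘ suc)))           ≡⟨ cong (λ x → + 2 * (g 0 + x)) (∑<-+ n a (g ∘ suc)) ⟨
  + 2 * (g 0 + ∑< n (λ l → a l + g (suc l)))        ≡⟨ cong (_*_ (+ 2)) (cong₂ _+_ first (∑<-cong n collect)) ⟩
  + 2 * ∑< (suc n) (λ l → coStirling₂ (suc t) l * [2+D]^ l ψ (+ suc t - + l)) ∎)
  where
  open ≡-Reasoning
  n = suc t ℕ.+ L
  a g : ℕ → ℤ
  a l = (+ t - + l) * coStirling₂ t l * [2+D]^ (suc l) ψ (+ t - + l)
  g l = coStirling₂ t l * [2+D]^ l ψ (+ suc t - + l)
  exchange : ∀ x y z → x + (y + z) ≡ y + (x + z)
  exchange = solve-∀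
  shift : ∀ t l → t - l + 1ℤ ≡ 1ℤ + t - l
  shift = solve-∀
  cancel : ∀ t l → 1ℤ + t - (1ℤ + l) ≡ t - l
  cancel = solve-∀
  restore : ∀ t l → t - l + l ≡ t
  restore = solve-∀
  identity : ∀ c y p q → c * (+ 2 * (y * p + q)) ≡ + 2 * (y * c * p + c * q)
  identity = solve-∀
  expand : ∀ l → coStirling₂ t l * [2+D]^ l (symmetrizedStep (+ t) ψ) (+ t - + l) ≡ + 2 * (a l + g l)
  expand l = begin
    coStirling₂ t l * [2+D]^ l (symmetrizedStep (+ t) ψ) y
      ≡⟨ cong (λ u → coStirling₂ t l * [2+D]^ l (symmetrizedStep u ψ) y) (restore (+ t) (+ l)) ⟨
    coStirling₂ t l * [2+D]^ l (symmetrizedStep (y + + l) ψ) y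
      ≡⟨ cong (_*_ (coStirling₂ t l)) ([2+D]^-symmetrizedStep l ψ y) ⟩
    coStirling₂ t l * (+ 2 * (y * [2+D]^ (suc l) ψ y + [2+D]^ l ψ (y + 1ℤ)))
      ≡⟨ identity (coStirling₂ t l) y ([2+D]^ (suc l) ψ y) ([2+D]^ l ψ (y + 1ℤ)) ⟩
    + 2 * (a l + coStirling₂ t l * [2+D]^ l ψ (y + 1ℤ))
      ≡⟨ cong (λ x → + 2 * (a l + coStirling₂ t l * [2+D]^ l ψ x)) (shift (+ t) (+ l)) ⟩
    + 2 * (a l + g l)                                       ∎
    where y = + t - + l
  last : ∑< (suc n) g ≡ ∑< n g
  last =
    trans (∑<-last n g) (trans (cong (λ x → ∑< n g + x * [2+D]^ n ψ (+ suc t - + n)) (coStirling₂-vanish t L)) (ℤ.+-identityʳ _))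
  first : g 0 ≡ coStirling₂ (suc t) 0 * ψ (+ suc t - 0ℤ)
  first = cong (_* ψ (+ suc t - 0ℤ)) (sym (coStirling₂-suc-0 t))
  distrib : ∀ x c c′ p → x * c * p + c′ * p ≡ (x * c + c′) * p
  distrib = solve-∀
  collect : ∀ l → a l + g (suc l) ≡ coStirling₂ (suc t) (suc l) * [2+D]^ (suc l) ψ (+ suc t - + suc l)
  collect l = begin
    a l + g (suc l)
      ≡⟨ cong (λ x → (+ t - + l) * coStirling₂ t l * [2+D]^ (suc l) ψ x + g (suc l)) (cancel (+ t) (+ l)) ⟨
    (+ t - + l) * coStirling₂ t l * [2+D]^ (suc l) ψ y + coStirling₂ t (suc l) * [2+D]^ (suc l) ψ y
      ≡⟨ distrib (+ t - + l) (coStirling₂ t l) (coStirling₂ t (suc l)) ([2+D]^ (suc l) ψ y) ⟩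
    ((+ t - + l) * coStirling₂ t l + coStirling₂ t (suc l)) * [2+D]^ (suc l) ψ y
      ≡⟨ cong (_* [2+D]^ (suc l) ψ y) (coStirling₂-suc-suc t l) ⟨
    coStirling₂ (suc t) (suc l) * [2+D]^ (suc l) ψ y ∎
    where y = + suc t - + suc l

-- Powers of 2 + D on a point mass

δ : ℤ → ℤ → ℤ
δ ρ r = if does (r ≟ ρ) then 1ℤ else 0ℤ

δ-≡ : ∀ ρ r → r ≡ ρ → δ ρ r ≡ 1ℤ
δ-≡ ρ r r≡ρ with r ≟ ρ
... | yes _   = refl
... | no  r≢ρ = contradiction r≡ρ r≢ρ

δ-≢ : ∀ ρ r → r ≢ ρ → δ ρ r ≡ 0ℤ
δ-≢ ρ r r≢ρ with r ≟ ρ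
... | yes r≡ρ = contradiction r≡ρ r≢ρ
... | no  _   = refl

δ-+suc : ∀ ρ i → δ ρ (ρ + + suc i) ≡ 0ℤ
δ-+suc ρ i =
  δ-≢ ρ (ρ + + suc i) λ eq → case (trans (sym (cancel ρ (+ suc i))) (trans (cong (_- ρ) eq) (ℤ.+-inverseʳ ρ)))
  where
  cancel : ∀ ρ x → ρ + x - ρ ≡ x
  cancel = solve-∀
  case : + suc i ≢ 0ℤ
  case ()

δ--suc : ∀ ρ i → δ ρ (ρ - + suc i) ≡ 0ℤ
δ--suc ρ i =
  δ-≢ ρ (ρ - + suc i) λ eq → case (trans (sym (cancel ρ (+ suc i))) (trans (cong (_- ρ) eq) (ℤ.+-inverseʳ ρ)))
  where
  cancel : ∀ ρ x → ρ - x - ρ ≡ - x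
  cancel = solve-∀
  case : -[1+ i ] ≢ 0ℤ
  case ()

1+D : (ℤ → ℤ) → ℤ → ℤ
1+D ψ r = ψ r + r * ψ (r - 1ℤ)

-- The coefficient of xʲ in (1 + x)(2 + x)ˡ.
coeff : ℕ → ℕ → ℤ
coeff zero    zero          = 1ℤ
coeff zero    (suc zero)    = 1ℤ
coeff zero    (suc (suc j)) = 0ℤ
coeff (suc l) zero          = + 2 * coeff l zero
coeff (suc l) (suc j)       = + 2 * coeff l (suc j) + coeff l j

coeff-vanish : ∀ l i → coeff l (suc (suc (l ℕ.+ i))) ≡ 0ℤ
coeff-vanish zero    i = refl
coeff-vanish (suc l) i rewrite sym (ℕ.+-suc l i) | coeff-vanish l (suc i) | ℕ.+-suc l i | coeff-vanish l i =
  refl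

-- The definition splits off the last factor; D, which multiplies by r and lowers the argument,
-- produces the first.
fallingFactorial-suc : ∀ x j → fallingFactorial x (suc j) ≡ x * fallingFactorial (x - 1ℤ) j
fallingFactorial-suc x zero    = identity x
  where
  identity : ∀ x → 1ℤ * (x - 0ℤ) ≡ x * 1ℤ
  identity = solve-∀
fallingFactorial-suc x (suc j) =
  trans (cong (_* (x - + suc j)) (fallingFactorial-suc x j))
        (identity x (fallingFactorial (x - 1ℤ) j) (+ j))
  where
  identity : ∀ x f j → x * f * (x - (1ℤ + j)) ≡ x * (f * (x - 1ℤ - j))
  identity = solve-∀

-- D looks only at smaller arguments, so a function that vanishes below ρ still does so after any
-- polynomial in D.
[2+D]^-below : ∀ l ρ i → [2+D]^ l (1+D (δ ρ)) (ρ - + suc i) ≡ 0ℤ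
[2+D]^-below zero    ρ i = begin
  δ ρ y + y * δ ρ (y - 1ℤ)          ≡⟨ cong (λ x → δ ρ y + y * δ ρ x) (assoc ρ (+ suc i)) ⟩
  δ ρ y + y * δ ρ (ρ - + suc (suc i)) ≡⟨ cong₂ (λ u v → u + y * v) (δ--suc ρ i) (δ--suc ρ (suc i)) ⟩
  0ℤ + y * 0ℤ                       ≡⟨ cong (_+_ 0ℤ) (ℤ.*-zeroʳ y) ⟩
  0ℤ                                ∎
  where
  open ≡-Reasoning
  y = ρ - + suc i
  assoc : ∀ ρ i → ρ - i - 1ℤ ≡ ρ - (1ℤ + i)
  assoc = solve-∀
[2+D]^-below (suc l) ρ i = begin
  + 2 * F y + y * F (y - 1ℤ)              ≡⟨ cong (λ x → + 2 * F y + y * F x) (assoc ρ (+ suc i)) ⟩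
  + 2 * F y + y * F (ρ - + suc (suc i))
    ≡⟨ cong₂ (λ u v → + 2 * u + y * v) ([2+D]^-below l ρ i) ([2+D]^-below l ρ (suc i)) ⟩
  0ℤ + y * 0ℤ                             ≡⟨ cong (_+_ 0ℤ) (ℤ.*-zeroʳ y) ⟩
  0ℤ                                      ∎
  where
  open ≡-Reasoning
  y = ρ - + suc i
  F = [2+D]^ l (1+D (δ ρ))
  assoc : ∀ ρ i → ρ - i - 1ℤ ≡ ρ - (1ℤ + i)
  assoc = solve-∀

-- Dʲ `(δ ρ)` is concentrated at ρ + j, with the value (ρ + j)_j. Evaluation at ρ + j thus extracts
-- the coefficient of Dʲ in (1 + D)(2 + D)ˡ.
[2+D]^-above : ∀ l ρ j → [2+D]^ l (1+D (δ ρ)) (ρ + + j) ≡ coeff l j * fallingFactorial (ρ + + j) j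
[2+D]^-above zero ρ zero = begin
  δ ρ y + y * δ ρ (y - 1ℤ)        ≡⟨ cong (λ x → δ ρ y + y * δ ρ x) (cong (_- 1ℤ) (ℤ.+-identityʳ ρ)) ⟩
  δ ρ y + y * δ ρ (ρ - 1ℤ)        ≡⟨ cong₂ (λ u v → u + y * v) (δ-≡ ρ (ρ + 0ℤ) (ℤ.+-identityʳ ρ)) (δ--suc ρ 0) ⟩
  1ℤ + y * 0ℤ                     ≡⟨ cong (_+_ 1ℤ) (ℤ.*-zeroʳ y) ⟩
  1ℤ                              ∎
  where
  open ≡-Reasoning
  y = ρ + 0ℤ
[2+D]^-above zero ρ (suc j) = begin
  δ ρ y + y * δ ρ (y - 1ℤ)        ≡⟨ cong₂ (λ u x → u + y * δ ρ x) (δ-+suc ρ j) (assoc ρ (+ j)) ⟩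
  0ℤ + y * δ ρ (ρ + + j)          ≡⟨ top j ⟩
  coeff 0 (suc j) * fallingFactorial y (suc j) ∎
  where
  open ≡-Reasoning
  y = ρ + + suc j
  assoc : ∀ ρ j → ρ + (1ℤ + j) - 1ℤ ≡ ρ + j
  assoc = solve-∀
  identity : ∀ y → 0ℤ + y * 1ℤ ≡ 1ℤ * (1ℤ * (y - 0ℤ))
  identity = solve-∀
  top : ∀ j → 0ℤ + (ρ + + suc j) * δ ρ (ρ + + j) ≡ coeff 0 (suc j) * fallingFactorial (ρ + + suc j) (suc j)
  top zero    rewrite δ-≡ ρ (ρ + 0ℤ) (ℤ.+-identityʳ ρ) = identity (ρ + + 1)
  top (suc j) rewrite δ-+suc ρ j = cong (_+_ 0ℤ) (ℤ.*-zeroʳ (ρ + + suc (suc j)))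
[2+D]^-above (suc l) ρ zero = begin
  + 2 * F y + y * F (y - 1ℤ)      ≡⟨ cong (λ x → + 2 * F y + y * F x) (cong (_- 1ℤ) (ℤ.+-identityʳ ρ)) ⟩
  + 2 * F y + y * F (ρ - 1ℤ)      ≡⟨ cong₂ (λ u v → + 2 * u + y * v) ([2+D]^-above l ρ 0) ([2+D]^-below l ρ 0) ⟩
  + 2 * (coeff l 0 * 1ℤ) + y * 0ℤ     ≡⟨ identity (coeff l 0) y ⟩
  + 2 * coeff l 0 * 1ℤ                ∎
  where
  open ≡-Reasoning
  y = ρ + 0ℤ
  F = [2+D]^ l (1+D (δ ρ))
  identity : ∀ g y → + 2 * (g * 1ℤ) + y * 0ℤ ≡ + 2 * g * 1ℤ
  identity = solve-∀
[2+D]^-above (suc l) ρ (suc j) = begin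
  + 2 * F y + y * F (y - 1ℤ)
    ≡⟨ cong (λ x → + 2 * F y + y * F x) (assoc ρ (+ j)) ⟩
  + 2 * F y + y * F (ρ + + j)
    ≡⟨ cong₂ (λ u v → + 2 * u + y * v) ([2+D]^-above l ρ (suc j)) ([2+D]^-above l ρ j) ⟩
  + 2 * (coeff l (suc j) * fallingFactorial y (suc j)) + y * (coeff l j * fallingFactorial (ρ + + j) j)
    ≡⟨ cong (λ x → + 2 * (coeff l (suc j) * fallingFactorial y (suc j)) + y * (coeff l j * fallingFactorial x j)) (assoc ρ (+ j)) ⟨
  + 2 * (coeff l (suc j) * fallingFactorial y (suc j)) + y * (coeff l j * fallingFactorial (y - 1ℤ) j)
    ≡⟨ cong (λ x → + 2 * (coeff l (suc j) * x) + y * (coeff l j * fallingFactorial (y - 1ℤ) j)) (fallingFactorial-suc y j) ⟩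
  + 2 * (coeff l (suc j) * (y * f)) + y * (coeff l j * f)
    ≡⟨ identity y (coeff l (suc j)) (coeff l j) f ⟩
  (+ 2 * coeff l (suc j) + coeff l j) * (y * f)
    ≡⟨ cong (_*_ (+ 2 * coeff l (suc j) + coeff l j)) (fallingFactorial-suc y j) ⟨
  (+ 2 * coeff l (suc j) + coeff l j) * fallingFactorial y (suc j) ∎
  where
  open ≡-Reasoning
  y = ρ + + suc j
  f = fallingFactorial (y - 1ℤ) j
  F = [2+D]^ l (1+D (δ ρ))
  assoc : ∀ ρ j → ρ + (1ℤ + j) - 1ℤ ≡ ρ + j
  assoc = solve-∀
  identity : ∀ y g h f → + 2 * (g * (y * f)) + y * (h * f) ≡ (+ 2 * g + h) * (y * f)
  identity = solve-∀

-- From `completions` to `total`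

boardSteps : ℕ → (ℤ → ℤ → ℤ) → ℤ → ℤ → ℤ
boardSteps zero    φ = φ
boardSteps (suc n) φ = rowStep (colStep (boardSteps n φ))

-- Regroups col (row col)ⁿ as (col row)ⁿ col; every pair of a column choice and the next row choice
-- is one `insertMax`.
total-colStep-boardSteps : ∀ t n φ → total t (colStep (boardSteps n φ)) ≡ total (t ℕ.+ n) (colStep φ)
total-colStep-boardSteps t zero    φ rewrite ℕ.+-identityʳ t = refl
total-colStep-boardSteps t (suc n) φ rewrite ℕ.+-suc t n = total-colStep-boardSteps (suc t) n φ

-- No row is free at the origin, so an extra `colStep` in front changes nothing. It supplies the
-- first insertion, and the true last column choice is left over at the end.
boardSteps-origin : ∀ n φ → boardSteps n φ 0ℤ 0ℤ ≡ total n (colStep φ)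
boardSteps-origin n φ = trans (sym (ℤ.+-identityʳ _)) (total-colStep-boardSteps 0 n φ)

-- A step adds at most one free row, so more than r + n free rows are out of reach.
boardSteps-beyond : ∀ n ρ i r b → ρ ≡ r + + n + + suc i → boardSteps n (lift (δ ρ)) r b ≡ 0ℤ
colStep-boardSteps-beyond : ∀ n ρ i r b → ρ ≡ r + + n + + suc i → colStep (boardSteps n (lift (δ ρ))) r b ≡ 0ℤ
boardSteps-beyond zero ρ i r b refl = trans (cong (δ ρ) (identity r (+ suc i))) (δ--suc ρ i)
  where
  identity : ∀ r x → r ≡ r + 0ℤ + x - x
  identity = solve-∀
boardSteps-beyond (suc n) ρ i r b eq =
  trans (cong₂ (λ u v → u + b * v)
          (colStep-boardSteps-beyond n ρ i (r + 1ℤ) (b + 1ℤ) (trans eq (identity₁ r (+ n) (+ suc i))))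
          (colStep-boardSteps-beyond n ρ (suc i) r b (trans eq (identity₂ r (+ n) (+ suc i)))))
        (cong (_+_ 0ℤ) (ℤ.*-zeroʳ b))
  where
  identity₁ : ∀ r n x → r + (1ℤ + n) + x ≡ r + 1ℤ + n + x
  identity₁ = solve-∀
  identity₂ : ∀ r n x → r + (1ℤ + n) + x ≡ r + n + (1ℤ + x)
  identity₂ = solve-∀
colStep-boardSteps-beyond n ρ i r b eq =
  trans (cong₂ (λ u v → u + r * v)
          (boardSteps-beyond n ρ i r b eq)
          (boardSteps-beyond n ρ (suc i) (r - 1ℤ) b (trans eq (identity r (+ n) (+ suc i)))))
        (cong (_+_ 0ℤ) (ℤ.*-zeroʳ r))
  where
  identity : ∀ r n x → r + n + x ≡ r - 1ℤ + n + (1ℤ + x)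
  identity = solve-∀

-- ρ is the number of rows left free at the end, so ρ + k = r + n throughout.
module _ (ρ : ℤ) where

  private
    solveρ : ∀ {x y} → ρ + x ≡ y → ρ ≡ y - x
    solveρ {x} refl = identity ρ x
      where
      identity : ∀ ρ x → ρ ≡ ρ + x - x
      identity = solve-∀

  -- Every rook occupies a row. The counter k can therefore be traded for a condition on the final
  -- state, the weight `δ ρ`, which linear operators can carry.
  completions-boardSteps : ∀ n r b k → ρ + + k ≡ + r + + n →
    + completions n r b k ≡ boardSteps n (lift (δ ρ)) (+ r) (+ b)
  completionsFromCol-boardSteps : ∀ n r b k → ρ + + k ≡ + r + + n →
    + completionsFromCol n r b k ≡ colStep (boardSteps n (lift (δ ρ))) (+ r) (+ b)
  completions-boardSteps zero r b zero eq =
    sym (δ-≡ ρ (+ r) (trans (sym (ℤ.+-identityʳ (+ r))) (trans (sym eq) (ℤ.+-identityʳ ρ))))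
  completions-boardSteps zero r b (suc k) eq =
    sym (trans (cong (δ ρ) (trans (sym (ℤ.+-identityʳ (+ r))) (sym eq))) (δ-+suc ρ k))
  -- With k = 0 `completions` stops, while the operators run on. A branch that places a further rook
  -- can no longer reach ρ free rows and contributes 0, which leaves the branch without rooks.
  completions-boardSteps (suc n) r b zero eq = sym (begin
    X (+ r + 1ℤ) (+ b + 1ℤ) + + b * X (+ r) (+ b)
      ≡⟨ cong₂ (λ u v → u + + b * v) top (colStep-boardSteps-beyond n ρ 0 (+ r) (+ b) bottom) ⟩
    1ℤ + + b * 0ℤ  ≡⟨ cong (_+_ 1ℤ) (ℤ.*-zeroʳ (+ b)) ⟩
    1ℤ ∎)
    where
    open ≡-Reasoning
    X = colStep (boardSteps n (lift (δ ρ)))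
    identity : ∀ r n → r + (1ℤ + n) - 0ℤ ≡ r + n + 1ℤ
    identity = solve-∀
    identity′ : ∀ r n → r + (1ℤ + n) ≡ 1ℤ + r + n
    identity′ = solve-∀
    bottom : ρ ≡ + r + + n + 1ℤ
    bottom = trans (solveρ eq) (identity (+ r) (+ n))
    top : X (+ r + 1ℤ) (+ b + 1ℤ) ≡ 1ℤ
    top = begin
      X (+ r + 1ℤ) (+ b + 1ℤ)  ≡⟨ cong₂ X (+suc r) (+suc b) ⟨
      X (+ suc r) (+ suc b)
        ≡⟨ completionsFromCol-boardSteps n (suc r) (suc b) 0 (trans eq (identity′ (+ r) (+ n))) ⟨
      1ℤ                       ∎
  completions-boardSteps (suc n) r b (suc k) eq = begin
    + (completionsFromCol n (suc r) (suc b) (suc k) ℕ.+ b ℕ.* completionsFromCol n r b k)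
      ≡⟨ trans (ℤ.pos-+ (completionsFromCol n (suc r) (suc b) (suc k)) _) (cong (_+_ (+ completionsFromCol n (suc r) (suc b) (suc k))) (ℤ.pos-* b (completionsFromCol n r b k))) ⟩
    + completionsFromCol n (suc r) (suc b) (suc k) + + b * + completionsFromCol n r b k
      ≡⟨ cong₂ (λ u v → u + + b * v) (completionsFromCol-boardSteps n (suc r) (suc b) (suc k) (trans eq (identity (+ r) (+ n))))
                                     (completionsFromCol-boardSteps n r b k (trans (down ρ (+ k)) (trans (cong (_- 1ℤ) eq) (sym (down (+ r) (+ n)))))) ⟩
    X (+ suc r) (+ suc b) + + b * X (+ r) (+ b)
      ≡⟨ cong (_+ + b * X (+ r) (+ b)) (cong₂ X (+suc r) (+suc b)) ⟩
    X (+ r + 1ℤ) (+ b + 1ℤ) + + b * X (+ r) (+ b) ∎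
    where
    open ≡-Reasoning
    X = colStep (boardSteps n (lift (δ ρ)))
    identity : ∀ r n → r + (1ℤ + n) ≡ 1ℤ + r + n
    identity = solve-∀
    down : ∀ x y → x + y ≡ x + (1ℤ + y) - 1ℤ
    down = solve-∀
  completionsFromCol-boardSteps n r b zero eq = sym (begin
    X (+ r) (+ b) + + r * X (+ r - 1ℤ) (+ b)
      ≡⟨ cong₂ (λ u v → u + + r * v) (sym (completions-boardSteps n r b 0 eq))
               (boardSteps-beyond n ρ 0 (+ r - 1ℤ) (+ b) (trans (solveρ eq) (identity (+ r) (+ n)))) ⟩
    1ℤ + + r * 0ℤ  ≡⟨ cong (_+_ 1ℤ) (ℤ.*-zeroʳ (+ r)) ⟩
    1ℤ ∎)
    where
    open ≡-Reasoning
    X = boardSteps n (lift (δ ρ))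
    identity : ∀ r n → r + n - 0ℤ ≡ r - 1ℤ + n + 1ℤ
    identity = solve-∀
  -- At r = 0 the arguments `pred r` and r - 1 differ, but both occur with the factor r = 0.
  completionsFromCol-boardSteps n zero b (suc k) eq =
    trans (cong +_ (ℕ.+-identityʳ (completions n 0 b (suc k)))) (trans (completions-boardSteps n 0 b (suc k) eq) (sym (ℤ.+-identityʳ _)))
  completionsFromCol-boardSteps n (suc r) b (suc k) eq = begin
    + (completions n (suc r) b (suc k) ℕ.+ suc r ℕ.* completions n r b k)
      ≡⟨ trans (ℤ.pos-+ (completions n (suc r) b (suc k)) _) (cong (_+_ (+ completions n (suc r) b (suc k))) (ℤ.pos-* (suc r) (completions n r b k))) ⟩
    + completions n (suc r) b (suc k) + + suc r * + completions n r b k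
      ≡⟨ cong₂ (λ u v → u + + suc r * v) (completions-boardSteps n (suc r) b (suc k) eq)
               (completions-boardSteps n r b k (trans (down ρ (+ k)) (trans (cong (_- 1ℤ) eq) (sym (down′ (+ r) (+ n)))))) ⟩
    X (+ suc r) (+ b) + + suc r * X (+ r) (+ b) ∎
    where
    open ≡-Reasoning
    X = boardSteps n (lift (δ ρ))
    down : ∀ x y → x + y ≡ x + (1ℤ + y) - 1ℤ
    down = solve-∀
    down′ : ∀ x y → x + y ≡ 1ℤ + x + y - 1ℤ
    down′ = solve-∀

-- The sum over j and its range

∑<-cong-< : ∀ n {f g} → (∀ i → i ℕ.< n → f i ≡ g i) → ∑< n f ≡ ∑< n g
∑<-cong-< zero    p = refl
∑<-cong-< (suc n) p = cong₂ _+_ (p 0 ℕ.z<s) (∑<-cong-< n λ i i<n → p (suc i) (ℕ.s<s i<n))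

∑<-reverse : ∀ k f → ∑< (suc k) f ≡ ∑< (suc k) (λ j → f (k ℕ.∸ j))
∑<-reverse zero    f = refl
∑<-reverse (suc k) f = begin
  ∑< (suc (suc k)) f                                ≡⟨ ∑<-last (suc k) f ⟩
  ∑< (suc k) f + f (suc k)                          ≡⟨ cong (_+ f (suc k)) (∑<-reverse k f) ⟩
  ∑< (suc k) (λ j → f (k ℕ.∸ j)) + f (suc k)        ≡⟨ ℤ.+-comm _ (f (suc k)) ⟩
  f (suc k) + ∑< (suc k) (λ j → f (k ℕ.∸ j))        ∎
  where open ≡-Reasoning

-- The summand of the theorem with l = k - j. The power of 2 and the bracket are merged into
-- `coeff`, which is integral even where the exponent k - 2j is negative.
term : ℕ → ℕ → ℕ → ℤ
term m k j = fallingFactorial (+ m - + (k ℕ.∸ j)) j * coStirling₂ m (k ℕ.∸ j) * coeff (k ℕ.∸ j) j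

pos-∸ : ∀ {j k} → j ℕ.≤ k → + (k ℕ.∸ j) ≡ + k - + j
pos-∸ {j} {k} j≤k = trans (sym (ℤ.⊖-≥ j≤k)) (sym (ℤ.m-n≡m⊖n k j))

completions-sum : ∀ m k → + completions m 0 0 k ≡ ∑< (suc ⌈ k /2⌉) (term m k)
completions-sum m k = begin
  + completions m 0 0 k
    ≡⟨ completions-boardSteps ρ m 0 0 k (balance (+ m) (+ k)) ⟩
  boardSteps m (lift (δ ρ)) 0ℤ 0ℤ                   ≡⟨ boardSteps-origin m (lift (δ ρ)) ⟩
  -- The leftover `colStep` acts on functions of r alone as 1 + D.
  total m (lift (1+D (δ ρ)))                      ≡⟨ total-closed m k (1+D (δ ρ)) ⟩
  ∑< (suc m ℕ.+ k) f                         ≡⟨ cong (λ n → ∑< (suc n) f) (ℕ.+-comm m k) ⟩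
  ∑< (suc k ℕ.+ m) f                         ≡⟨ ∑<-++ (suc k) m f ⟩
  -- For l > k the argument m - l lies below ρ = m - k, where `[2+D]^-below` gives 0.
  ∑< (suc k) f + ∑< m (f ∘ (suc k ℕ.+_))     ≡⟨ cong (_+_ (∑< (suc k) f)) (∑<-zero m below) ⟩
  ∑< (suc k) f + 0ℤ                          ≡⟨ ℤ.+-identityʳ _ ⟩
  ∑< (suc k) f                               ≡⟨ ∑<-reverse k f ⟩
  ∑< (suc k) (λ j → f (k ℕ.∸ j))             ≡⟨ ∑<-cong-< (suc k) (λ j j<1+k → above j (ℕ.s≤s⁻¹ j<1+k)) ⟩
  ∑< (suc k) (term m k)                      ≡⟨ cong (λ n → ∑< (suc n) (term m k)) halves ⟨
  -- For j > ⌈k/2⌉ the degree l + 1 = k - j + 1 of (1 + x)(2 + x)ˡ is less than j, so `coeff`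
  -- vanishes.
  ∑< (suc ⌈ k /2⌉ ℕ.+ ⌊ k /2⌋) (term m k)    ≡⟨ ∑<-++ (suc ⌈ k /2⌉) ⌊ k /2⌋ (term m k) ⟩
  ∑< (suc ⌈ k /2⌉) (term m k) + ∑< ⌊ k /2⌋ (term m k ∘ (suc ⌈ k /2⌉ ℕ.+_))
    ≡⟨ cong (_+_ (∑< (suc ⌈ k /2⌉) (term m k))) (trans (∑<-cong-< ⌊ k /2⌋ tail) (∑<-zero ⌊ k /2⌋ λ _ → refl)) ⟩
  ∑< (suc ⌈ k /2⌉) (term m k) + 0ℤ           ≡⟨ ℤ.+-identityʳ _ ⟩
  ∑< (suc ⌈ k /2⌉) (term m k)                ∎
  where
  open ≡-Reasoning
  ρ = + m - + k
  f : ℕ → ℤ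
  f l = coStirling₂ m l * [2+D]^ l (1+D (δ ρ)) (+ m - + l)
  balance : ∀ m k → m - k + k ≡ 0ℤ + m
  balance = solve-∀
  halves : ⌈ k /2⌉ ℕ.+ ⌊ k /2⌋ ≡ k
  halves = trans (ℕ.+-comm ⌈ k /2⌉ ⌊ k /2⌋) (ℕ.⌊n/2⌋+⌈n/2⌉≡n k)
  assoc : ∀ m k i → m - (1ℤ + (k + i)) ≡ m - k - (1ℤ + i)
  assoc = solve-∀
  below : ∀ i → f (suc k ℕ.+ i) ≡ 0ℤ
  below i =
    trans (cong (λ x → coStirling₂ m (suc k ℕ.+ i) * [2+D]^ (suc k ℕ.+ i) (1+D (δ ρ)) x) (assoc (+ m) (+ k) (+ i)))
              (trans (cong (_*_ (coStirling₂ m (suc k ℕ.+ i))) ([2+D]^-below (suc k ℕ.+ i) ρ i)) (ℤ.*-zeroʳ (coStirling₂ m (suc k ℕ.+ i))))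
  regroup : ∀ m k j → m - (k - j) ≡ m - k + j
  regroup = solve-∀
  permute : ∀ c g f → c * (g * f) ≡ f * c * g
  permute = solve-∀
  above : ∀ j → j ℕ.≤ k → f (k ℕ.∸ j) ≡ term m k j
  above j j≤k = begin
    coStirling₂ m l * [2+D]^ l (1+D (δ ρ)) (+ m - + l)
      ≡⟨ cong (λ x → coStirling₂ m l * [2+D]^ l (1+D (δ ρ)) x) eq ⟩
    coStirling₂ m l * [2+D]^ l (1+D (δ ρ)) (ρ + + j)
      ≡⟨ cong (_*_ (coStirling₂ m l)) ([2+D]^-above l ρ j) ⟩
    coStirling₂ m l * (coeff l j * fallingFactorial (ρ + + j) j)
      ≡⟨ cong (λ x → coStirling₂ m l * (coeff l j * fallingFactorial x j)) eq ⟨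
    coStirling₂ m l * (coeff l j * fallingFactorial (+ m - + l) j) ≡⟨ permute (coStirling₂ m l) (coeff l j) _ ⟩
    term m k j ∎
    where
    l = k ℕ.∸ j
    eq : + m - + l ≡ ρ + + j
    eq = trans (cong (λ x → + m - x) (pos-∸ j≤k)) (regroup (+ m) (+ k) (+ j))
  tail : ∀ i → i ℕ.< ⌊ k /2⌋ → term m k (suc ⌈ k /2⌉ ℕ.+ i) ≡ 0ℤ
  tail i i<f =
    trans (cong (_*_ (fallingFactorial (+ m - + l) j * coStirling₂ m l)) vanish) (ℤ.*-zeroʳ (fallingFactorial (+ m - + l) j * coStirling₂ m l))
    where
    h = ⌈ k /2⌉
    j = suc h ℕ.+ i
    l = k ℕ.∸ j
    l<h : l ℕ.< h
    l<h = ℕ.<-≤-trans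
      (subst (ℕ._< ⌊ k /2⌋) (trans (sym (ℕ.[m+n]∸[m+o]≡n∸o h ⌊ k /2⌋ (suc i))) (cong₂ ℕ._∸_ halves (ℕ.+-suc h i)))
        (ℕ.∸-monoʳ-< {⌊ k /2⌋} {suc i} {0} ℕ.z<s i<f))
      (ℕ.⌊n/2⌋≤⌈n/2⌉ k)
    vanish : coeff l j ≡ 0ℤ
    vanish with d , eq ← ℕ.m≤n⇒∃[o]m+o≡n (ℕ.≤-trans (s≤s l<h) (ℕ.m≤m+n (suc h) i)) =
      trans (cong (coeff l) (sym eq)) (coeff-vanish l d)

-- Passage to the rationals

ι : ℤ → ℚ
ι i = i / 1

ι-+ : ∀ a b → ι a +ℚ ι b ≡ ι (a + b)
ι-+ a b = ℚ.toℚᵘ-injective (begin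
  toℚᵘ (ι a +ℚ ι b)                ≈⟨ ℚ.toℚᵘ-homo-+ (ι a) (ι b) ⟩
  toℚᵘ (ι a) ℚᵘ+ toℚᵘ (ι b)        ≈⟨ ℚᵘ.+-cong (ℚ.toℚᵘ-fromℚᵘ (mkℚᵘ a 0)) (ℚ.toℚᵘ-fromℚᵘ (mkℚᵘ b 0)) ⟩
  mkℚᵘ a 0 ℚᵘ+ mkℚᵘ b 0            ≈⟨ *≡* (identity a b) ⟩
  mkℚᵘ (a + b) 0                   ≈⟨ ℚ.toℚᵘ-fromℚᵘ (mkℚᵘ (a + b) 0) ⟨
  toℚᵘ (ι (a + b))                 ∎)
  where
  open import Data.Rational.Unnormalised using () renaming (_+_ to _ℚᵘ+_)
  open import Relation.Binary.Reasoning.Setoid ℚᵘ.≃-setoid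
  identity : ∀ a b → (a * 1ℤ + b * 1ℤ) * 1ℤ ≡ (a + b) * 1ℤ
  identity = solve-∀

-- One cross-multiplication serves all the divisions: d = 1 yields `ι-*`, and a = b = 1 the inverse
-- of d.
/-*-ι : ∀ a b d .{{_ : NonZero d}} → (a / d) *ℚ ι (b * + d) ≡ ι (a * b)
/-*-ι a b d@(suc d-1) = ℚ.toℚᵘ-injective (begin
  toℚᵘ (a / d *ℚ ι (b * + d))            ≈⟨ ℚ.toℚᵘ-homo-* (a / d) (ι (b * + d)) ⟩
  toℚᵘ (a / d) ℚᵘ* toℚᵘ (ι (b * + d))    ≈⟨ ℚᵘ.*-cong (ℚ.toℚᵘ-fromℚᵘ (mkℚᵘ a d-1)) (ℚ.toℚᵘ-fromℚᵘ (mkℚᵘ (b * + d) 0)) ⟩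
  mkℚᵘ a d-1 ℚᵘ* mkℚᵘ (b * + d) 0        ≈⟨ *≡* cross ⟩
  mkℚᵘ (a * b) 0                         ≈⟨ ℚ.toℚᵘ-fromℚᵘ (mkℚᵘ (a * b) 0) ⟨
  toℚᵘ (ι (a * b))                       ∎)
  where
  open import Data.Rational.Unnormalised using () renaming (_*_ to _ℚᵘ*_)
  open import Relation.Binary.Reasoning.Setoid ℚᵘ.≃-setoid
  identity : ∀ a b d → a * (b * d) * 1ℤ ≡ a * b * d
  identity = solve-∀
  cross : a * (b * + d) * 1ℤ ≡ a * b * + (d ℕ.* 1)
  cross = trans (identity a b (+ d)) (cong (λ x → a * b * + x) (sym (ℕ.*-identityʳ d)))

ι-* : ∀ a b → ι a *ℚ ι b ≡ ι (a * b)
ι-* a b = trans (cong (λ x → ι a *ℚ ι x) (sym (ℤ.*-identityʳ b))) (/-*-ι a b 1)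

*ℚ-cancel-ι : ∀ d .{{_ : NonZero d}} x y → x *ℚ ι (+ d) ≡ y *ℚ ι (+ d) → x ≡ y
*ℚ-cancel-ι d x y eq = begin
  x                            ≡⟨ undo x ⟨
  x *ℚ ι (+ d) *ℚ (1ℤ / d)     ≡⟨ cong (_*ℚ (1ℤ / d)) eq ⟩
  y *ℚ ι (+ d) *ℚ (1ℤ / d)     ≡⟨ undo y ⟩
  y                            ∎
  where
  open ≡-Reasoning
  inverse : ι (+ d) *ℚ (1ℤ / d) ≡ ι 1ℤ
  inverse =
    trans (ℚ.*-comm (ι (+ d)) (1ℤ / d)) (trans (cong (λ x → (1ℤ / d) *ℚ ι x) (sym (ℤ.*-identityˡ (+ d)))) (/-*-ι 1ℤ 1ℤ d))
  undo : ∀ z → z *ℚ ι (+ d) *ℚ (1ℤ / d) ≡ z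
  undo z = trans (ℚ.*-assoc z (ι (+ d)) (1ℤ / d)) (trans (cong (z *ℚ_) inverse) (ℚ.*-identityʳ z))

[a*d]/d : ∀ a d .{{_ : NonZero d}} → (a * + d) / d ≡ ι a
[a*d]/d a d = *ℚ-cancel-ι d _ _ (begin
  (a * + d) / d *ℚ ι (+ d)          ≡⟨ cong (λ x → (a * + d) / d *ℚ ι x) (ℤ.*-identityˡ (+ d)) ⟨
  (a * + d) / d *ℚ ι (1ℤ * + d)     ≡⟨ /-*-ι (a * + d) 1ℤ d ⟩
  ι (a * + d * 1ℤ)                  ≡⟨ cong ι (ℤ.*-identityʳ (a * + d)) ⟩
  ι (a * + d)                       ≡⟨ ι-* a (+ d) ⟨
  ι a *ℚ ι (+ d)                    ∎)
  where open ≡-Reasoning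

-- Binomial coefficients and powers of 2

fallingFactorial-C : ∀ n r → fallingFactorial (+ n) r ≡ + (n C r) * + (r !)
fallingFactorial-C n       zero    = refl
fallingFactorial-C zero    (suc r) =
  trans (fallingFactorial-suc 0ℤ r) (sym (cong (λ x → + x * + (suc r !)) (k>n⇒nCk≡0 {0} {suc r} ℕ.z<s)))
fallingFactorial-C (suc n) (suc r) = begin
  fallingFactorial (+ suc n) (suc r)              ≡⟨ fallingFactorial-suc (+ suc n) r ⟩
  -- Since n + 1 = (r + 1) + (n - r), what follows is Pascal's rule multiplied by (r + 1)!.
  + suc n * fallingFactorial (+ n) r              ≡⟨ split (+ n) (+ r) (fallingFactorial (+ n) r) ⟩
  + suc r * fallingFactorial (+ n) r + fallingFactorial (+ n) (suc r)
    ≡⟨ cong₂ (λ x y → + suc r * x + y) (fallingFactorial-C n r) (fallingFactorial-C n (suc r)) ⟩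
  + suc r * (+ (n C r) * + (r !)) + + (n C suc r) * + (suc r !)
    ≡⟨ cong (λ x → + suc r * (+ (n C r) * + (r !)) + + (n C suc r) * x) (ℤ.pos-* (suc r) (r !)) ⟩
  + suc r * (+ (n C r) * + (r !)) + + (n C suc r) * (+ suc r * + (r !))
    ≡⟨ collect (+ suc r) (+ (n C r)) (+ (n C suc r)) (+ (r !)) ⟩
  (+ (n C r) + + (n C suc r)) * (+ suc r * + (r !))
    ≡⟨ cong₂ _*_ (cong +_ (nCk+nC[k+1]≡[n+1]C[k+1] n r)) (sym (ℤ.pos-* (suc r) (r !))) ⟩
  + (suc n C suc r) * + (suc r !) ∎
  where
  open ≡-Reasoning
  split : ∀ n r f → (1ℤ + n) * f ≡ (1ℤ + r) * f + f * (n - r)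
  split = solve-∀
  collect : ∀ s a b f → s * (a * f) + b * (s * f) ≡ (a + b) * (s * f)
  collect = solve-∀

extBinomial-C : ∀ n r → extBinomial (+ n) (+ r) ≡ ι (+ (n C r))
extBinomial-C n r =
  trans (cong (λ x → (x / r !) {{r ℕ.!≢0}}) (fallingFactorial-C n r)) ([a*d]/d (+ (n C r)) (r !) {{r ℕ.!≢0}})

-- C(l, j - 1), which is 0 at j = 0.
C-pred : ℕ → ℕ → ℕ
C-pred l zero    = 0
C-pred l (suc j) = l C j

C-pred-rec : ∀ l j → C-pred (suc l) (suc j) ≡ C-pred l j ℕ.+ C-pred l (suc j)
C-pred-rec l zero    = refl
C-pred-rec l (suc j) = sym (nCk+nC[k+1]≡[n+1]C[k+1] l j)

extBinomial-C-pred : ∀ l j → extBinomial (+ l) (+ j - 1ℤ) ≡ ι (+ C-pred l j)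
extBinomial-C-pred l zero    = refl
extBinomial-C-pred l (suc j) = extBinomial-C l j

binomialSum : ℕ → ℕ → ℤ
binomialSum l j = + C-pred l j + + (suc l C j)

binomialSum-rec : ∀ l j → binomialSum (suc l) (suc j) ≡ binomialSum l j + binomialSum l (suc j)
binomialSum-rec l j = begin
  + C-pred (suc l) (suc j) + + (suc (suc l) C suc j)
    ≡⟨ cong₂ _+_ (cong +_ (C-pred-rec l j)) (cong +_ (sym (nCk+nC[k+1]≡[n+1]C[k+1] (suc l) j))) ⟩
  + C-pred l j + + C-pred l (suc j) + (+ (suc l C j) + + (suc l C suc j))
    ≡⟨ interchange (+ C-pred l j) (+ C-pred l (suc j)) (+ (suc l C j)) (+ (suc l C suc j)) ⟩
  binomialSum l j + binomialSum l (suc j) ∎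
  where
  open ≡-Reasoning
  interchange : ∀ a b c d → a + b + (c + d) ≡ a + c + (b + d)
  interchange = solve-∀

-- Replacing x by 2x gives (1 + 2x)(2 + 2x)ˡ = 2ˡ ((1 + x)ˡ⁺¹ + x (1 + x)ˡ); compare coefficients of
-- xʲ. The factor 2ʲ stays on the left because l - j may be negative.
coeff-binomialSum : ∀ l j → + (2 ℕ.^ j) * coeff l j ≡ + (2 ℕ.^ l) * binomialSum l j
coeff-binomialSum zero    zero          = refl
coeff-binomialSum zero    (suc zero)    = refl
coeff-binomialSum zero    (suc (suc j)) =
  trans (ℤ.*-zeroʳ (+ (2 ℕ.^ suc (suc j)))) (sym (cong₂ (λ x y → 1ℤ * (+ x + + y)) (k>n⇒nCk≡0 {0} {suc j} ℕ.z<s) (k>n⇒nCk≡0 {1} {suc (suc j)} (ℕ.s<s ℕ.z<s))))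
coeff-binomialSum (suc l) zero    = begin
  1ℤ * (+ 2 * coeff l 0)      ≡⟨ pull (coeff l 0) ⟩
  + 2 * (1ℤ * coeff l 0)      ≡⟨ cong (_*_ (+ 2)) (coeff-binomialSum l 0) ⟩
  + 2 * (+ (2 ℕ.^ l) * binomialSum l 0) ≡⟨ ℤ.*-assoc (+ 2) (+ (2 ℕ.^ l)) (binomialSum l 0) ⟨
  + 2 * + (2 ℕ.^ l) * binomialSum l 0 ≡⟨ cong (_* binomialSum l 0) (ℤ.pos-* 2 (2 ℕ.^ l)) ⟨
  + (2 ℕ.^ suc l) * binomialSum (suc l) 0 ∎
  where
  open ≡-Reasoning
  pull : ∀ g → 1ℤ * (+ 2 * g) ≡ + 2 * (1ℤ * g)
  pull = solve-∀
coeff-binomialSum (suc l) (suc j) = begin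
  + (2 ℕ.^ suc j) * (+ 2 * coeff l (suc j) + coeff l j)
    ≡⟨ expand (+ (2 ℕ.^ suc j)) (coeff l (suc j)) (coeff l j) ⟩
  + 2 * (+ (2 ℕ.^ suc j) * coeff l (suc j)) + + (2 ℕ.^ suc j) * coeff l j
    ≡⟨ cong₂ (λ x y → + 2 * x + y * coeff l j) (coeff-binomialSum l (suc j)) (ℤ.pos-* 2 (2 ℕ.^ j)) ⟩
  + 2 * (+ (2 ℕ.^ l) * binomialSum l (suc j)) + + 2 * + (2 ℕ.^ j) * coeff l j
    ≡⟨ cong (_+_ (+ 2 * (+ (2 ℕ.^ l) * binomialSum l (suc j)))) (trans (ℤ.*-assoc (+ 2) (+ (2 ℕ.^ j)) (coeff l j)) (cong (_*_ (+ 2)) (coeff-binomialSum l j))) ⟩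
  + 2 * (+ (2 ℕ.^ l) * binomialSum l (suc j)) + + 2 * (+ (2 ℕ.^ l) * binomialSum l j)
    ≡⟨ collect (+ (2 ℕ.^ l)) (binomialSum l (suc j)) (binomialSum l j) ⟩
  + 2 * + (2 ℕ.^ l) * (binomialSum l j + binomialSum l (suc j))
    ≡⟨ cong₂ _*_ (ℤ.pos-* 2 (2 ℕ.^ l)) (binomialSum-rec l j) ⟨
  + (2 ℕ.^ suc l) * binomialSum (suc l) (suc j) ∎
  where
  open ≡-Reasoning
  expand : ∀ p g h → p * (+ 2 * g + h) ≡ + 2 * (p * g) + p * h
  expand = solve-∀
  collect : ∀ p x y → + 2 * (p * x) + + 2 * (p * y) ≡ + 2 * p * (y + x)
  collect = solve-∀

2^-- : ∀ a b → 2^ (+ a - + b) *ℚ ι (+ (2 ℕ.^ b)) ≡ ι (+ (2 ℕ.^ a))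
2^-- a b with ℕ.compare a b
... | ℕ.equal _ =
  trans (cong (λ x → 2^ x *ℚ ι (+ (2 ℕ.^ a))) (ℤ.+-inverseʳ (+ a))) (trans (ι-* 1ℤ (+ (2 ℕ.^ a))) (cong ι (ℤ.*-identityˡ (+ (2 ℕ.^ a)))))
... | ℕ.greater _ d = begin
  2^ (+ suc (b ℕ.+ d) - + b) *ℚ ι (+ (2 ℕ.^ b)) ≡⟨ cong (λ x → 2^ x *ℚ ι (+ (2 ℕ.^ b))) (cancel (+ b) (+ d)) ⟩
  ι (+ (2 ℕ.^ suc d)) *ℚ ι (+ (2 ℕ.^ b))        ≡⟨ ι-* (+ (2 ℕ.^ suc d)) (+ (2 ℕ.^ b)) ⟩
  ι (+ (2 ℕ.^ suc d) * + (2 ℕ.^ b))             ≡⟨ cong ι (ℤ.pos-* (2 ℕ.^ suc d) (2 ℕ.^ b)) ⟨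
  ι (+ (2 ℕ.^ suc d ℕ.* 2 ℕ.^ b))               ≡⟨ cong (λ x → ι (+ x)) (ℕ.^-distribˡ-+-* 2 (suc d) b) ⟨
  ι (+ (2 ℕ.^ (suc d ℕ.+ b)))                   ≡⟨ cong (λ x → ι (+ (2 ℕ.^ suc x))) (ℕ.+-comm d b) ⟩
  ι (+ (2 ℕ.^ suc (b ℕ.+ d)))                   ∎
  where
  open ≡-Reasoning
  cancel : ∀ b d → 1ℤ + (b + d) - b ≡ 1ℤ + d
  cancel = solve-∀
... | ℕ.less _ d = begin
  2^ (+ a - + suc (a ℕ.+ d)) *ℚ ι (+ (2 ℕ.^ suc (a ℕ.+ d)))
    ≡⟨ cong₂ (λ x y → 2^ x *ℚ ι y) (cancel (+ a) (+ d)) power ⟩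
  2^ -[1+ d ] *ℚ ι (+ (2 ℕ.^ a) * + (2 ℕ.^ suc d))
    ≡⟨ /-*-ι 1ℤ (+ (2 ℕ.^ a)) (2 ℕ.^ suc d) {{ℕ.m^n≢0 2 (suc d)}} ⟩
  ι (1ℤ * + (2 ℕ.^ a))                             ≡⟨ cong ι (ℤ.*-identityˡ (+ (2 ℕ.^ a))) ⟩
  ι (+ (2 ℕ.^ a))                                  ∎
  where
  open ≡-Reasoning
  cancel : ∀ a d → a - (1ℤ + (a + d)) ≡ - (1ℤ + d)
  cancel = solve-∀
  power : + (2 ℕ.^ suc (a ℕ.+ d)) ≡ + (2 ℕ.^ a) * + (2 ℕ.^ suc d)
  power =
    trans (cong (λ x → + (2 ℕ.^ x)) (sym (ℕ.+-suc a d))) (trans (cong +_ (ℕ.^-distribˡ-+-* 2 a (suc d))) (ℤ.pos-* (2 ℕ.^ a) (2 ℕ.^ suc d)))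

coeff-ℚ : ∀ l j → 2^ (+ l - + j) *ℚ ι (binomialSum l j) ≡ ι (coeff l j)
coeff-ℚ l j = *ℚ-cancel-ι (2 ℕ.^ j) {{ℕ.m^n≢0 2 j}} _ _ (begin
  2^ (+ l - + j) *ℚ ι (binomialSum l j) *ℚ p     ≡⟨ ℚ.*-assoc (2^ (+ l - + j)) (ι (binomialSum l j)) p ⟩
  2^ (+ l - + j) *ℚ (ι (binomialSum l j) *ℚ p)
    ≡⟨ cong (2^ (+ l - + j) *ℚ_) (ℚ.*-comm (ι (binomialSum l j)) p) ⟩
  2^ (+ l - + j) *ℚ (p *ℚ ι (binomialSum l j))   ≡⟨ ℚ.*-assoc (2^ (+ l - + j)) p (ι (binomialSum l j)) ⟨
  2^ (+ l - + j) *ℚ p *ℚ ι (binomialSum l j)     ≡⟨ cong (_*ℚ ι (binomialSum l j)) (2^-- l j) ⟩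
  ι (+ (2 ℕ.^ l)) *ℚ ι (binomialSum l j)         ≡⟨ ι-* (+ (2 ℕ.^ l)) (binomialSum l j) ⟩
  ι (+ (2 ℕ.^ l) * binomialSum l j)              ≡⟨ cong ι (coeff-binomialSum l j) ⟨
  ι (+ (2 ℕ.^ j) * coeff l j)              ≡⟨ cong ι (ℤ.*-comm (+ (2 ℕ.^ j)) (coeff l j)) ⟩
  ι (coeff l j * + (2 ℕ.^ j))              ≡⟨ ι-* (coeff l j) (+ (2 ℕ.^ j)) ⟨
  ι (coeff l j) *ℚ p                       ∎)
  where
  open ≡-Reasoning
  p = ι (+ (2 ℕ.^ j))

-- The rational summands

∑-ι : ∀ n f g → (∀ i → i ℕ.< suc n → g i ≡ ι (f i)) → ∑[0⋯ n ] g ≡ ι (∑< (suc n) f)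
∑-ι n f g p = trans (cong (foldr _+ℚ_ 0ℚ) (map-upTo g (suc n))) (go (suc n) f g p)
  where
  go : ∀ n f g → (∀ i → i ℕ.< n → g i ≡ ι (f i)) → foldr _+ℚ_ 0ℚ (applyUpTo g n) ≡ ι (∑< n f)
  go zero    f g p = refl
  go (suc n) f g p =
    trans (cong₂ _+ℚ_ (p 0 ℕ.z<s) (go n (f ∘ suc) (g ∘ suc) λ i i<n → p (suc i) (ℕ.s<s i<n))) (ι-+ (f 0) _)

-- For j ≤ k the upper binomial arguments are natural numbers. The only negative lower one is j - 1
-- at j = 0, where the convention gives 0, as does `C-pred`.
term-ℚ : ∀ m k j → j ℕ.≤ k →
  (fallingFactorial (+ m - + k + + j) j / 1)
  *ℚ (+ extStirling₂ (+ m) (+ m - + k + + j) / 1)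
  *ℚ (2^ (+ k - + 2 * + j))
  *ℚ (extBinomial (+ k - + j) (+ j - 1ℤ) +ℚ extBinomial (+ k - + j + 1ℤ) (+ j))
  ≡ ι (term m k j)
term-ℚ m k j j≤k = begin
  ι (fallingFactorial (+ m - + k + + j) j)
  *ℚ ι (+ extStirling₂ (+ m) (+ m - + k + + j))
  *ℚ (2^ (+ k - + 2 * + j))
  *ℚ (extBinomial (+ k - + j) (+ j - 1ℤ) +ℚ extBinomial (+ k - + j + 1ℤ) (+ j))
    ≡⟨ cong₂ (λ x y → ι (fallingFactorial x j) *ℚ ι (+ extStirling₂ (+ m) x) *ℚ (2^ y)
               *ℚ (extBinomial (+ k - + j) (+ j - 1ℤ) +ℚ extBinomial (+ k - + j + 1ℤ) (+ j)))
         (trans (regroup (+ m) (+ k) (+ j)) (cong (λ x → + m - x) (sym l≡)))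
         (trans (regroup′ (+ k) (+ j)) (cong (λ x → x - + j) (sym l≡))) ⟩
  ι f *ℚ ι s *ℚ p *ℚ (extBinomial (+ k - + j) (+ j - 1ℤ) +ℚ extBinomial (+ k - + j + 1ℤ) (+ j))
    ≡⟨ cong (λ x → ι f *ℚ ι s *ℚ p *ℚ (extBinomial x (+ j - 1ℤ) +ℚ extBinomial (x + 1ℤ) (+ j))) l≡ ⟨
  ι f *ℚ ι s *ℚ p *ℚ (extBinomial (+ l) (+ j - 1ℤ) +ℚ extBinomial (+ l + 1ℤ) (+ j))
    ≡⟨ cong (λ x → ι f *ℚ ι s *ℚ p *ℚ x) (cong₂ _+ℚ_ (extBinomial-C-pred l j)
         (trans (cong (λ x → extBinomial x (+ j)) (sym (+suc l))) (extBinomial-C (suc l) j))) ⟩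
  ι f *ℚ ι s *ℚ p *ℚ (ι (+ C-pred l j) +ℚ ι (+ (suc l C j)))
    ≡⟨ cong (ι f *ℚ ι s *ℚ p *ℚ_) (ι-+ (+ C-pred l j) (+ (suc l C j))) ⟩
  ι f *ℚ ι s *ℚ p *ℚ ι (binomialSum l j)
    ≡⟨ ℚ.*-assoc (ι f *ℚ ι s) p (ι (binomialSum l j)) ⟩
  ι f *ℚ ι s *ℚ (p *ℚ ι (binomialSum l j))
    ≡⟨ cong₂ _*ℚ_ (ι-* f s) (coeff-ℚ l j) ⟩
  ι (f * s) *ℚ ι (coeff l j)
    ≡⟨ ι-* (f * s) (coeff l j) ⟩
  ι (term m k j) ∎
  where
  open ≡-Reasoning
  l = k ℕ.∸ j
  f = fallingFactorial (+ m - + l) j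
  s = coStirling₂ m l
  p = 2^ (+ l - + j)
  l≡ : + l ≡ + k - + j
  l≡ = pos-∸ j≤k
  regroup : ∀ m k j → m - k + j ≡ m - (k - j)
  regroup = solve-∀
  regroup′ : ∀ k j → k - + 2 * j ≡ k - j - j
  regroup′ = solve-∀

theorem3p2 : ∀ (m k : ℕ) →
  + A-S m k / 1 ≡
    ∑[0⋯ ⌈ k /2⌉ ] (λ j →
      (fallingFactorial (+ m - + k + + j) j / 1)
      *ℚ (+ extStirling₂ (+ m) (+ m - + k + + j) / 1)
      *ℚ (2^ (+ k - + 2 * + j))
      *ℚ (extBinomial (+ k - + j) (+ j - 1ℤ) +ℚ extBinomial (+ k - + j + 1ℤ) (+ j)))
theorem3p2 m k = begin
  ι (+ A-S m k)                       ≡⟨ cong (λ n → ι (+ n)) (A-S≡completions m k) ⟩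
  ι (+ completions m 0 0 k)                     ≡⟨ cong ι (completions-sum m k) ⟩
  ι (∑< (suc ⌈ k /2⌉) (term m k))     ≡⟨ ∑-ι ⌈ k /2⌉ (term m k) _ (λ j j<1+h →
                                           term-ℚ m k j (ℕ.≤-trans (ℕ.s≤s⁻¹ j<1+h) (ℕ.⌈n/2⌉≤n k))) ⟨
  _                                   ∎
  where open ≡-Reasoning
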